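{- Let $\ell$ be an odd prime, let $m\ge 0$ be an integer, and put $k=\ell m+(\ell-1)$. Let $q=e^{2\pi i\tau}$, $\zeta=e^{2\pi i z}$, and define $$C_{k,2}(z,\tau)=\prod_{n=1}^\infty\frac{(1+\zeta^{2}q^n)(1+\zeta^{ -2}q^n)}{(1-q^n)^m\Big[\prod_{a\in\{1,3,5,\dots,\ell-2\}}(1-\zeta^{a}q^n)(1-\zeta^{ -a}q^n)\Big]^{m+1}}.$$ Then $C_{k,2}$ is a crank generating function for $p_{k,2}(n)$, i.e. setting $\zeta=1$ gives $\sum_{n\ge0}p_{k,2}(n)q^n$, and it explains the congruences $p_{k,2}(\ell n+\delta)\equiv 0\pmod{\ell}$ for every integer $\delta$ such that $8\delta+1$ is a quadratic non-residue modulo $\ell$: for every such $\delta$ and every integer $n\ge 0$, the coefficient of $q^{\ell n+\delta}$ in $C_{k,2}(z,\tau)$ (a Laurent polynomial in $\zeta$ with integer coefficients) is divisible by the $\ell$-th cyclotomic polynomial $\Phi_\ell(\zeta)$ (equivalently, vanishes at $\zeta=e^{2\pi i/\ell}$); in particular $p_{k,2}(\ell n+\delta)\equiv 0\pmod{\ell}$.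
   Context: For nonnegative integers $k,j$, $p_{k,j}(n)$ denotes the number of $(k+j)$-colored partitions of $n$ in which $j$ of the colors have distinct parts, i.e. $\sum_{n\ge0}p_{k,j}(n)q^n=\prod_{n\ge1}\frac{(1+q^n)^j}{(1-q^n)^k}$. An integer $a$ is a quadratic non-residue modulo $\ell$ if $a$ is not congruent to any square $x^2$ (including $0$) modulo $\ell$. -}

module Defs where

open import Data.Nat as ℕ using (ℕ; zero; suc; _∸_)
open import Data.Nat.DivMod using (_/_; _%_)
open import Data.Integer as ℤ using (ℤ; +_; -[1+_])
open import Data.Integer.Divisibility as ℤD using ()
open import Data.List using (List; []; _∷_; _++_; map; concatMap; upTo; foldr)
open import Data.Product using (Σ; _×_; _,_)
open import Data.Bool using (Bool; true; false; if_then_else_)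
open import Relation.Nullary using (¬_)
open import Relation.Nullary.Decidable using (⌊_⌋)
open import Relation.Binary.PropositionalEquality using (_≡_)

module SeriesOps {A : Set} (0# 1# : A) (_+_ _*_ : A → A → A) where

  Series : Set
  Series = ℕ → A

  sumTo : (ℕ → A) → ℕ → A
  sumTo f zero    = f zero
  sumTo f (suc N) = sumTo f N + f (suc N)

  oneS : Series
  oneS zero    = 1#
  oneS (suc _) = 0#

  _*S_ : Series → Series → Series
  (f *S g) N = sumTo (λ i → f i * g (N ∸ i)) N

  powS : Series → ℕ → Series
  powS f zero    = oneS
  powS f (suc j) = f *S powS f j

  powA : A → ℕ → A
  powA x zero    = 1#
  powA x (suc j) = x * powA x j

  -- 1 + x q^n   (n = suc n')
  onePlus : A → ℕ → Series
  onePlus x n' zero = 1#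
  onePlus x n' (suc i) = if ⌊ i ℕ.≟ n' ⌋ then x else 0#

  -- 1 / (1 - x q^n) = Σ_j x^j q^{n j}   (n = suc n')
  geom : A → ℕ → Series
  geom x n' i = if ⌊ i % suc n' ℕ.≟ 0 ⌋ then powA x (i / suc n') else 0#

  -- ∏_{n=1}^{M} F n, where F receives n' with n = suc n'
  prodTo : (ℕ → Series) → ℕ → Series
  prodTo F zero    = oneS
  prodTo F (suc M) = prodTo F M *S F M

  prodList : List Series → Series
  prodList = foldr _*S_ oneS

-- Laurent polynomials in ζ with integer coefficients, as a finite list of
-- terms (c , e) meaning c·ζ^e.  Equality is coefficientwise (coeffL).

LPoly : Set
LPoly = List (ℤ × ℤ)

zeroL oneL : LPoly
zeroL = []
oneL  = (+ 1 , + 0) ∷ []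

zetaL : ℤ → LPoly
zetaL e = (+ 1 , e) ∷ []

_+L_ : LPoly → LPoly → LPoly
_+L_ = _++_

_*L_ : LPoly → LPoly → LPoly
f *L g = concatMap (λ { (c , e) → map (λ { (d , e') → (c ℤ.* d , e ℤ.+ e') }) g }) f

coeffL : LPoly → ℤ → ℤ
coeffL [] j = + 0
coeffL ((c , e) ∷ f) j = (if ⌊ e ℤ.≟ j ⌋ then c else + 0) ℤ.+ coeffL f j

eval1 : LPoly → ℤ
eval1 [] = + 0
eval1 ((c , e) ∷ f) = c ℤ.+ eval1 f

-- the ℓ-th cyclotomic polynomial for ℓ prime: 1 + ζ + ... + ζ^{ℓ-1}
Φ : ℕ → LPoly
Φ ℓ = map (λ i → (+ 1 , + i)) (upTo ℓ)

_∣L_ : LPoly → LPoly → Set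
f ∣L g = Σ LPoly (λ h → (j : ℤ) → coeffL g j ≡ coeffL (f *L h) j)

module NS = SeriesOps {ℕ} 0 1 ℕ._+_ ℕ._*_

pFactor : ℕ → ℕ → ℕ → NS.Series
pFactor k j n' = NS.powS (NS.onePlus 1 n') j NS.*S NS.powS (NS.geom 1 n') k

-- factors with index n > N do not affect the coefficient of q^N
p : ℕ → ℕ → ℕ → ℕ
p k j N = NS.prodTo (pFactor k j) N N

pZ : ℕ → ℕ → ℤ → ℕ
pZ k j (+ N)     = p k j N
pZ k j -[1+ _ ]  = 0

module LS = SeriesOps {LPoly} zeroL oneL _+L_ _*L_

oddsBelow : ℕ → List ℕ
oddsBelow ℓ = map (λ i → 1 ℕ.+ 2 ℕ.* i) (upTo (ℓ / 2))

CFactor : ℕ → ℕ → ℕ → LS.Series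
CFactor ℓ m n' =
  LS.onePlus (zetaL (+ 2)) n' LS.*S
  (LS.onePlus (zetaL (ℤ.- (+ 2))) n' LS.*S
  (LS.powS (LS.geom oneL n') m LS.*S
   LS.powS (LS.prodList (map (λ a → LS.geom (zetaL (+ a)) n' LS.*S LS.geom (zetaL (ℤ.- (+ a))) n')
                             (oddsBelow ℓ))) (suc m)))

Ccoef : ℕ → ℕ → ℕ → LPoly
Ccoef ℓ m N = LS.prodTo (CFactor ℓ m) N N

CcoefZ : ℕ → ℕ → ℤ → LPoly
CcoefZ ℓ m (+ N)    = Ccoef ℓ m N
CcoefZ ℓ m -[1+ _ ] = zeroL

-- a is a quadratic non-residue modulo ℓ (0 counts as a square)

QNR : ℤ → ℕ → Set
QNR a ℓ = ¬ Σ ℤ (λ x → (+ ℓ) ℤD.∣ (a ℤ.- x ℤ.* x))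

{-# OPTIONS --safe #-}

-- Modulo Φ_ℓ the exponents ±1, ±3, …, ±(ℓ−2) run through all nonzero residues, so the
-- denominator of C_{k,2}, completed by a factor 1 − qⁿ, becomes a power of ∏ (1 − q^(ℓn)):
-- it only involves powers of q^ℓ.  What remains is the product
-- ∏ (1 + z qⁿ)(1 + z⁻¹ qⁿ)(1 − qⁿ) with z = ζ², which by the Jacobi triple product is
-- supported on the triangular numbers t = r (r + 1) / 2, the unit 1 + z being divided out.
-- As 8 t + 1 = (2 r + 1)², the coefficient of q^N can be nonzero modulo Φ_ℓ only if 8 N + 1
-- is a square modulo ℓ.  Both the triple product and the identity ∏ (1 + ζ^i x) = 1 + x^ℓ
-- are instances of the q-binomial theorem: for formal q, up to terms beyond q^N, and for
-- q = ζ, where the inner Gaussian binomials vanish.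

module Submission where

open import Defs

open import Algebra.Bundles using (CommutativeRing)
open import Data.Bool using (if_then_else_)
open import Data.Empty using (⊥-elim)
open import Data.Integer as ℤ using (ℤ; +_)
open import Data.Integer.Divisibility.Signed using (divides; ∣⇒∣ᵤ)
import Data.Integer.Properties as ℤₚ
open import Data.Integer.Solver using (module +-*-Solver)
open import Data.List using (List; []; _∷_; _++_; map; applyUpTo; length; upTo)
import Data.List.Properties as Listₚ
open import Data.Nat as ℕ using (ℕ; zero; suc)
open import Data.Nat.Coprimality as Coprimality using (Coprime; coprime-Bézout; prime⇒coprime)
open import Data.Nat.Divisibility as ℕ∣ using (_∣_)
open import Data.Nat.DivMod using (_/_; _%_; m<n⇒m%n≡m; [m+n]%n≡m%n; m/n≡1+[m∸n]/n;
  m*n/n≡m; +-distrib-/-∣ʳ; m≡m%n+[m/n]*n; m%n<n)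
open import Data.Nat.GCD using (module Bézout)
open import Data.Nat.Primality using (Prime; prime⇒irreducible; ¬prime[1])
import Data.Nat.Properties as ℕₚ
open import Data.Nat.Solver using () renaming (module +-*-Solver to ℕ-Solver)
open import Data.Product using (∃; _×_; _,_; proj₁; proj₂)
open import Data.Sum using (_⊎_; inj₁; inj₂)
open import Function using (flip)
open import Level using (0ℓ)
open import Relation.Binary.PropositionalEquality as ≡ using (_≡_)
open import Relation.Nullary using (¬_; yes; no)
open import Relation.Nullary.Decidable using (⌊_⌋; from-no)

-- Divisibility by Φ is treated as vanishing in ℤ[ζ, ζ⁻¹]/(Φ), and no cancellation or embedding into
-- ℂ is used there. Whatever has to be divided out is exhibited as a unit: the sum [k] = 1 + ... +
-- ζ^(k-1) for k prime to ℓ, by Bézout, and 1 + ζ² as a factor of [4]. For the same reason the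
-- Gaussian binomials come from Pascal's rule, and their factorial formula survives only as
-- identities between products. The triple product is never taken to the limit. It is used with N
-- factors 1 + z qⁿ and N + 1 factors z + qʲ, the extra one being the unit z + 1. Its summand at k +
-- l = 2 N + 1 carries q^T, where T is the triangular number of r = k - N - 1, together with (1 -
-- q)...(1 - q^N) times a Gaussian binomial. That last product has no term between q and q^min(k,l),
-- and T + min(k,l) + 1 > N, so up to q^N the summand consists of its triangular term alone. The
-- congruence for p then costs only the evaluation Φ(1) = ℓ.

-- Triangular numbers of integers, without subtraction

tri : ℕ → ℕ
tri zero    = 0
tri (suc k) = suc k ℕ.+ tri k

-- tri∸ k b is r (r + 1) / 2 for the integer r = k − b.
tri∸ : ℕ → ℕ → ℕ
tri∸ k       zero    = tri k
tri∸ zero    (suc b) = tri b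
tri∸ (suc k) (suc b) = tri∸ k b

tri∸-zero : ∀ b → tri∸ 0 (suc b) ≡ b ℕ.+ tri∸ 0 b
tri∸-zero zero    = ≡.refl
tri∸-zero (suc b) = ≡.refl

-- With t(r) = r (r + 1) / 2 and r = k - b this is t(r + 1) = t(r) + r + 1, with b moved to the left
-- to stay in ℕ.
tri∸-step : ∀ k b → b ℕ.+ tri∸ (suc k) b ≡ tri∸ k b ℕ.+ suc k
tri∸-step k       zero    = ℕₚ.+-comm (suc k) (tri k)
tri∸-step zero    (suc b) = begin
  suc (b ℕ.+ tri∸ 0 b)    ≡⟨ ≡.cong suc (tri∸-zero b) ⟨
  suc (tri∸ 0 (suc b))    ≡⟨ ℕₚ.+-comm 1 _ ⟩
  tri∸ 0 (suc b) ℕ.+ 1    ∎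
  where open ≡.≡-Reasoning
tri∸-step (suc k) (suc b) = begin
  suc (b ℕ.+ tri∸ (suc k) b)  ≡⟨ ≡.cong suc (tri∸-step k b) ⟩
  suc (tri∸ k b ℕ.+ suc k)    ≡⟨ ℕₚ.+-suc _ (suc k) ⟨
  tri∸ k b ℕ.+ suc (suc k)    ∎
  where open ≡.≡-Reasoning

tri∸≡tri : ∀ k b → ∃ λ r → tri∸ k b ≡ tri r
tri∸≡tri k       zero    = k , ≡.refl
tri∸≡tri zero    (suc b) = b , ≡.refl
tri∸≡tri (suc k) (suc b) = tri∸≡tri k b

n≤tri[n] : ∀ n → n ℕ.≤ tri n
n≤tri[n] zero    = ℕ.z≤n
n≤tri[n] (suc n) = ℕₚ.m≤m+n (suc n) (tri n)

-- For r = k - b it amounts to 0 ≤ t(r) + r + 1 = t(r + 1). At b = N + 1 it bounds the summands of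
-- the triple product with k ≤ N.
b≤tri∸+1+k : ∀ k b → b ℕ.≤ tri∸ k b ℕ.+ suc k
b≤tri∸+1+k k       zero    = ℕ.z≤n
b≤tri∸+1+k zero    (suc b) = ≡.subst (suc b ℕ.≤_) (ℕₚ.+-comm 1 (tri b)) (ℕ.s≤s (n≤tri[n] b))
b≤tri∸+1+k (suc k) (suc b) =
  ≡.subst (suc b ℕ.≤_) (≡.sym (ℕₚ.+-suc _ (suc k))) (ℕ.s≤s (b≤tri∸+1+k k b))

-- For r = k - b it amounts to 0 ≤ t(r) - r = t(r - 1).
k≤tri∸+b : ∀ k b → k ℕ.≤ tri∸ k b ℕ.+ b
k≤tri∸+b k       zero    = ≡.subst (k ℕ.≤_) (≡.sym (ℕₚ.+-identityʳ _)) (n≤tri[n] k)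
k≤tri∸+b zero    (suc b) = ℕ.z≤n
k≤tri∸+b (suc k) (suc b) =
  ≡.subst (suc k ℕ.≤_) (≡.sym (ℕₚ.+-suc _ b)) (ℕ.s≤s (k≤tri∸+b k b))

-- The counterpart of `b≤tri∸+1+k` for the summands with k > N: the relation between k and l trades
-- the bound on k for one on l.
N<tri∸+1+l : ∀ k l N → k ℕ.+ l ≡ suc N ℕ.+ N → N ℕ.< tri∸ k (suc N) ℕ.+ suc l
N<tri∸+1+l k l N k+l≡ = ℕₚ.+-cancelʳ-≤ (suc N) (suc N) (T ℕ.+ suc l) (begin
  suc N ℕ.+ suc N           ≡⟨ ℕₚ.+-suc (suc N) N ⟩
  suc (suc N ℕ.+ N)         ≡⟨ ≡.cong suc k+l≡ ⟨
  suc (k ℕ.+ l)             ≡⟨ ℕₚ.+-suc k l ⟨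
  k ℕ.+ suc l               ≤⟨ ℕₚ.+-monoˡ-≤ (suc l) (k≤tri∸+b k (suc N)) ⟩
  T ℕ.+ suc N ℕ.+ suc l     ≡⟨ ℕₚ.+-assoc T (suc N) (suc l) ⟩
  T ℕ.+ (suc N ℕ.+ suc l)   ≡⟨ ≡.cong (T ℕ.+_) (ℕₚ.+-comm (suc N) (suc l)) ⟩
  T ℕ.+ (suc l ℕ.+ suc N)   ≡⟨ ℕₚ.+-assoc T (suc l) (suc N) ⟨
  T ℕ.+ suc l ℕ.+ suc N     ∎)
  where
  open ℕₚ.≤-Reasoning
  T : ℕ
  T = tri∸ k (suc N)

-- Antidiagonal sums and finite products in a commutative ring

module SumsAndProducts (R : CommutativeRing 0ℓ 0ℓ) where

  open CommutativeRing R hiding (zero)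
  open import Algebra.Properties.CommutativeSemigroup *-commutativeSemigroup
    using () renaming (interchange to *-interchange)
  open import Algebra.Properties.CommutativeSemigroup +-commutativeSemigroup
    using () renaming (interchange to +-interchange)
  open import Algebra.Properties.Semiring.Exp semiring using (_^_)
  open import Relation.Binary.Reasoning.Setoid setoid

  -- The sum of f over the pairs (k , l) with k + l = n.
  diag : (ℕ → ℕ → Carrier) → ℕ → Carrier
  diag f zero    = f 0 0
  diag f (suc n) = f 0 (suc n) + diag (λ k l → f (suc k) l) n

  diag-cong : ∀ {f g} n → (∀ k l → k ℕ.+ l ≡ n → f k l ≈ g k l) → diag f n ≈ diag g n
  diag-cong zero    f≈g = f≈g 0 0 ≡.refl
  diag-cong (suc n) f≈g =
    +-cong (f≈g 0 (suc n) ≡.refl) (diag-cong n λ k l e → f≈g (suc k) l (≡.cong suc e))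

  diag-+ : ∀ f g n → diag (λ k l → f k l + g k l) n ≈ diag f n + diag g n
  diag-+ f g zero    = refl
  diag-+ f g (suc n) = trans (+-congˡ (diag-+ _ _ n)) (+-interchange _ _ _ _)

  diag-*ˡ : ∀ x f n → x * diag f n ≈ diag (λ k l → x * f k l) n
  diag-*ˡ x f zero    = refl
  diag-*ˡ x f (suc n) = trans (distribˡ _ _ _) (+-congˡ (diag-*ˡ x _ n))

  diag-last : ∀ f n → diag f (suc n) ≈ diag (λ k l → f k (suc l)) n + f (suc n) 0
  diag-last f zero    = refl
  diag-last f (suc n) = trans (+-congˡ (diag-last (λ k l → f (suc k) l) n)) (sym (+-assoc _ _ _))

  diag≈0 : ∀ n {f} → (∀ k l → k ℕ.+ l ≡ n → f k l ≈ 0#) → diag f n ≈ 0#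
  diag≈0 zero    f≈0 = f≈0 0 0 ≡.refl
  diag≈0 (suc n) f≈0 = trans
    (+-cong (f≈0 0 (suc n) ≡.refl) (diag≈0 n λ k l e → f≈0 (suc k) l (≡.cong suc e)))
    (+-identityˡ 0#)

  diag-flip : ∀ f n → diag f n ≈ diag (flip f) n
  diag-flip f zero    = refl
  diag-flip f (suc n) = begin
    f 0 (suc n) + diag (λ k l → f (suc k) l) n  ≈⟨ +-congˡ (diag-flip _ n) ⟩
    f 0 (suc n) + diag (λ k l → f (suc l) k) n  ≈⟨ +-comm _ _ ⟩
    diag (λ k l → f (suc l) k) n + f 0 (suc n)  ≈⟨ diag-last (flip f) n ⟨
    diag (flip f) (suc n)                       ∎

  -- Pascal's rule in bulk: an interior term has two parents, each end term only one. Multiplying a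
  -- sum by a linear factor gives two sums, which this merges into a single longer one.
  diag-pascal : ∀ e f g →
                (∀ k l → e (suc k) (suc l) ≈ f k (suc l) + g (suc k) l) →
                (∀ k → e (suc k) 0 ≈ f k 0) →
                (∀ l → e 0 (suc l) ≈ g 0 l) →
                ∀ n → diag e (suc n) ≈ diag f n + diag g n
  diag-pascal e f g inner e-f e-g zero    = trans (+-comm _ _) (+-cong (e-f 0) (e-g 0))
  diag-pascal e f g inner e-f e-g (suc n) = begin
    e 0 (suc (suc n)) + diag (λ k l → e (suc k) l) (suc n)
      ≈⟨ +-cong (e-g (suc n)) (diag-last (λ k l → e (suc k) l) n) ⟩
    g 0 (suc n) + (diag (λ k l → e (suc k) (suc l)) n + e (suc (suc n)) 0)
      ≈⟨ +-congˡ (+-cong (trans (diag-cong n λ k l _ → inner k l) (diag-+ _ _ n)) (e-f (suc n))) ⟩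
    g 0 (suc n) + ((diag (λ k l → f k (suc l)) n + diag (λ k l → g (suc k) l) n) + f (suc n) 0)
      ≈⟨ +-congˡ (trans (+-assoc _ _ _) (trans (+-congˡ (+-comm _ _)) (sym (+-assoc _ _ _)))) ⟩
    g 0 (suc n) + ((diag (λ k l → f k (suc l)) n + f (suc n) 0) + diag (λ k l → g (suc k) l) n)
      ≈⟨ +-congˡ (+-congʳ (diag-last f n)) ⟨
    g 0 (suc n) + (diag f (suc n) + diag (λ k l → g (suc k) l) n)
      ≈⟨ trans (sym (+-assoc _ _ _)) (trans (+-congʳ (+-comm _ _)) (+-assoc _ _ _)) ⟩
    diag f (suc n) + diag g (suc n) ∎

  Π : (ℕ → Carrier) → ℕ → Carrier
  Π F zero    = 1#
  Π F (suc n) = Π F n * F n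

  Π-cong : ∀ {F G} n → (∀ i → i ℕ.< n → F i ≈ G i) → Π F n ≈ Π G n
  Π-cong zero    F≈G = refl
  Π-cong (suc n) F≈G =
    *-cong (Π-cong n λ i i<n → F≈G i (ℕₚ.m≤n⇒m≤1+n i<n)) (F≈G n ℕₚ.≤-refl)

  Π-* : ∀ F G n → Π (λ i → F i * G i) n ≈ Π F n * Π G n
  Π-* F G zero    = sym (*-identityˡ 1#)
  Π-* F G (suc n) = trans (*-congʳ (Π-* F G n)) (*-interchange _ _ _ _)

  Π-one : ∀ n → Π (λ _ → 1#) n ≈ 1#
  Π-one zero    = refl
  Π-one (suc n) = trans (*-identityʳ _) (Π-one n)

  Π-const : ∀ x n → Π (λ _ → x) n ≈ x ^ n
  Π-const x zero    = refl
  Π-const x (suc n) = trans (*-congʳ (Π-const x n)) (*-comm _ _)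

  Π-head : ∀ F n → Π F (suc n) ≈ F 0 * Π (λ i → F (suc i)) n
  Π-head F zero    = *-comm _ _
  Π-head F (suc n) = trans (*-congʳ (Π-head F n)) (*-assoc _ _ _)

  Π-reverse : ∀ F G n → (∀ i j → suc (i ℕ.+ j) ≡ n → F i ≈ G j) → Π F n ≈ Π G n
  Π-reverse F G zero    F≈G = refl
  Π-reverse F G (suc n) F≈G = begin
    Π F n * F n                    ≈⟨ *-cong
                                        (Π-reverse F (λ j → G (suc j)) n λ i j e →
                                          F≈G i (suc j) (≡.cong suc (≡.trans (ℕₚ.+-suc i j) e)))
                                        (F≈G n 0 (≡.cong suc (ℕₚ.+-identityʳ n))) ⟩
    Π (λ j → G (suc j)) n * G 0    ≈⟨ *-comm _ _ ⟩
    G 0 * Π (λ j → G (suc j)) n    ≈⟨ Π-head G n ⟨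
    Π G (suc n)                    ∎

  Π-even-odd : ∀ F h → Π F (h ℕ.+ h) ≈ Π (λ i → F (i ℕ.+ i)) h * Π (λ i → F (suc (i ℕ.+ i))) h
  Π-even-odd F zero = sym (*-identityˡ 1#)
  Π-even-odd F (suc h) rewrite ℕₚ.+-suc h h =
    trans (*-assoc _ _ _) (trans (*-congʳ (Π-even-odd F h)) (*-interchange _ _ _ _))

-- Gaussian binomials and the finite triple product

module QBinomial (R : CommutativeRing 0ℓ 0ℓ) (u : CommutativeRing.Carrier R) where

  open CommutativeRing R hiding (zero)
  open SumsAndProducts R
  open import Algebra.Properties.CommutativeSemiring.Exp commutativeSemiring
    using (_^_; ^-homo-*; ^-distrib-*)
  open import Algebra.Properties.Ring ring using (-‿distribʳ-*)
  open import Algebra.Solver.Ring.NaturalCoefficients.Default commutativeSemiring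
    using (solve; _:+_; _:*_; _:=_; con)
  open import Relation.Binary.Reasoning.Setoid setoid

  -- The q-integer 1 + u + ... + u^(n-1) in Horner form.
  [_] : ℕ → Carrier
  [ zero  ] = 0#
  [ suc n ] = 1# + u * [ n ]

  [+] : ∀ m n → [ m ℕ.+ n ] ≈ [ m ] + u ^ m * [ n ]
  [+] zero    n = solve 1 (λ x → x := con 0 :+ con 1 :* x) refl _
  [+] (suc m) n = trans (+-congˡ (*-congˡ ([+] m n)))
    (solve 4 (λ u a b c → con 1 :+ u :* (a :+ b :* c) := (con 1 :+ u :* a) :+ (u :* b) :* c)
       refl _ _ _ _)

  -- The Gaussian binomial coefficient [k+l choose k] at u.
  B : ℕ → ℕ → Carrier
  B zero    l       = 1#
  B (suc k) zero    = 1#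
  B (suc k) (suc l) = B k (suc l) + u ^ suc k * B (suc k) l

  B-zeroʳ : ∀ k → B k 0 ≈ 1#
  B-zeroʳ zero    = refl
  B-zeroʳ (suc k) = refl

  -- Together with the next rule this replaces the quotient of q-factorials, since q-integers need
  -- not be cancellable. The inductions are intertwined: the Pascal step of either rule calls on
  -- both.
  [1+k]*B : ∀ k l → [ suc k ] * B (suc k) l ≈ [ suc k ℕ.+ l ] * B k l
  [1+l]*B : ∀ k l → [ suc l ] * B k (suc l) ≈ [ suc k ℕ.+ l ] * B k l

  [1+k]*B k zero rewrite ℕₚ.+-identityʳ k = *-congˡ (sym (B-zeroʳ k))
  [1+k]*B zero (suc l) = begin
    [ 1 ] * (1# + u ^ 1 * B 1 l)
      ≈⟨ solve 2 (λ u b → (con 1 :+ u :* con 0) :* (con 1 :+ (u :* con 1) :* b)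
           := con 1 :+ u :* ((con 1 :+ u :* con 0) :* b)) refl u (B 1 l) ⟩
    1# + u * ([ 1 ] * B 1 l)         ≈⟨ +-congˡ (*-congˡ ([1+k]*B zero l)) ⟩
    1# + u * ([ suc l ] * 1#)        ≈⟨ +-congˡ (*-congˡ (*-identityʳ _)) ⟩
    [ suc (suc l) ]                  ≈⟨ *-identityʳ _ ⟨
    [ suc (suc l) ] * 1#             ∎
  [1+k]*B (suc k) (suc l) = begin
    [ suc (suc k) ] * (b + w * B (suc (suc k)) l)
      ≈⟨ solve 4 (λ x b w c → x :* (b :+ w :* c) := x :* b :+ w :* (x :* c)) refl _ _ _ _ ⟩
    [ suc (suc k) ] * b + w * ([ suc (suc k) ] * B (suc (suc k)) l)
      -- Both rules evaluate to the same multiple of `B (suc k) l`, so one left side may be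
      -- exchanged for the other; this makes `b` a common factor.
      ≈⟨ +-congˡ (*-congˡ (trans ([1+k]*B (suc k) l) (sym ([1+l]*B (suc k) l)))) ⟩
    [ suc (suc k) ] * b + w * ([ suc l ] * b)
      ≈⟨ solve 4 (λ x b w y → x :* b :+ w :* (y :* b) := (x :+ w :* y) :* b) refl _ _ _ _ ⟩
    ([ suc (suc k) ] + w * [ suc l ]) * b
      ≈⟨ *-congʳ ([+] (suc (suc k)) (suc l)) ⟨
    [ suc (suc k) ℕ.+ suc l ] * b ∎
    where
    b w : Carrier
    b = B (suc k) (suc l)
    w = u ^ suc (suc k)

  [1+l]*B zero    l = refl
  [1+l]*B (suc k) l = begin
    [ suc l ] * (B k (suc l) + w * b)
      ≈⟨ solve 4 (λ x c w b → x :* (c :+ w :* b) := x :* c :+ w :* (x :* b)) refl _ _ _ _ ⟩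
    [ suc l ] * B k (suc l) + w * ([ suc l ] * b)
      ≈⟨ +-congʳ (trans ([1+l]*B k l) (sym ([1+k]*B k l))) ⟩
    [ suc k ] * b + w * ([ suc l ] * b)
      ≈⟨ solve 4 (λ x b w y → x :* b :+ w :* (y :* b) := (x :+ w :* y) :* b) refl _ _ _ _ ⟩
    ([ suc k ] + w * [ suc l ]) * b
      ≈⟨ *-congʳ ([+] (suc k) (suc l)) ⟨
    [ suc k ℕ.+ suc l ] * b
      ≡⟨ ≡.cong (λ n → [ n ] * b) (ℕₚ.+-suc (suc k) l) ⟩
    [ suc (suc k) ℕ.+ l ] * b ∎
    where
    b w : Carrier
    b = B (suc k) l
    w = u ^ suc k

  [1-u]*[n] : ∀ n → (1# - u) * [ n ] ≈ 1# - u ^ n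
  [1-u]*[n] zero    = trans (zeroʳ _) (sym (-‿inverseʳ 1#))
  [1-u]*[n] (suc n) = begin
    (1# - u) * (1# + u * [ n ])
      ≈⟨ solve 3 (λ x u b → x :* (con 1 :+ u :* b) := x :+ u :* (x :* b)) refl (1# - u) u [ n ] ⟩
    (1# - u) + u * ((1# - u) * [ n ])
      ≈⟨ +-congˡ (*-congˡ ([1-u]*[n] n)) ⟩
    (1# - u) + u * (1# - u ^ n)
      ≈⟨ +-congˡ (trans (distribˡ u 1# _) (+-cong (*-identityʳ u) (sym (-‿distribʳ-* u _)))) ⟩
    (1# - u) + (u - u * u ^ n)
      ≈⟨ solve 3 (λ m u y → (con 1 :+ m) :+ (u :+ y) := con 1 :+ ((m :+ u) :+ y)) refl (- u) u _ ⟩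
    1# + ((- u + u) - u * u ^ n)
      ≈⟨ +-congˡ (trans (+-congʳ (-‿inverseˡ u)) (+-identityˡ _)) ⟩
    1# - u ^ suc n ∎

  -- Multiplying by 1 - u turns q-integers into factors 1 - u^n; only this direction is free of
  -- division.
  [1-u^]-from-[] : ∀ m n {b c} → [ m ] * b ≈ [ n ] * c → (1# - u ^ m) * b ≈ (1# - u ^ n) * c
  [1-u^]-from-[] m n {b} {c} mb≈nc = begin
    (1# - u ^ m) * b         ≈⟨ *-congʳ ([1-u]*[n] m) ⟨
    (1# - u) * [ m ] * b     ≈⟨ *-assoc _ _ _ ⟩
    (1# - u) * ([ m ] * b)   ≈⟨ *-congˡ mb≈nc ⟩
    (1# - u) * ([ n ] * c)   ≈⟨ *-assoc _ _ _ ⟨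
    (1# - u) * [ n ] * c     ≈⟨ *-congʳ ([1-u]*[n] n) ⟩
    (1# - u ^ n) * c         ∎

  -- The induction splits off the first factor: what remains is the same product at x u, and the
  -- extra u^k in (x u)^k is the weight in Pascal's rule for `B`.
  q-binomial-theorem : ∀ x n →
    Π (λ i → 1# + x * u ^ suc i) n ≈ diag (λ k l → x ^ k * (u ^ tri k * B k l)) n
  q-binomial-theorem x zero    = solve 0 (con 1 := con 1 :* (con 1 :* con 1)) refl
  q-binomial-theorem x (suc n) = begin
    Π (λ i → 1# + x * u ^ suc i) (suc n)
      ≈⟨ Π-head _ n ⟩
    (1# + x * u ^ 1) * Π (λ i → 1# + x * u ^ suc (suc i)) n
      ≈⟨ *-cong (+-congˡ (*-congˡ (*-identityʳ u)))
           (trans (Π-cong n λ i _ → +-congˡ (sym (*-assoc _ _ _)))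
                  (q-binomial-theorem (x * u) n)) ⟩
    (1# + x * u) * diag g n
      ≈⟨ solve 2 (λ y d → (con 1 :+ y) :* d := y :* d :+ d) refl _ _ ⟩
    x * u * diag g n + diag g n
      ≈⟨ +-congʳ (diag-*ˡ _ g n) ⟩
    diag (λ k l → x * u * g k l) n + diag g n
      ≈⟨ diag-pascal e _ g inner edge-k edge-l n ⟨
    diag e (suc n) ∎
    where
    e g : ℕ → ℕ → Carrier
    e k l = x ^ k * (u ^ tri k * B k l)
    g k l = (x * u) ^ k * (u ^ tri k * B k l)

    shift : ∀ k b → x ^ suc k * (u ^ tri (suc k) * b) ≈ x * u * ((x * u) ^ k * (u ^ tri k * b))
    shift k b = begin
      x ^ suc k * (u ^ tri (suc k) * b)
        ≈⟨ *-congˡ (*-congʳ (^-homo-* u (suc k) (tri k))) ⟩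
      x * x ^ k * ((u * u ^ k * u ^ tri k) * b)
        ≈⟨ solve 6 (λ x y u v w b → (x :* y) :* (((u :* v) :* w) :* b)
             := (x :* u) :* ((y :* v) :* (w :* b))) refl x (x ^ k) u (u ^ k) (u ^ tri k) b ⟩
      x * u * (x ^ k * u ^ k * (u ^ tri k * b))
        ≈⟨ *-congˡ (*-congʳ (^-distrib-* x u k)) ⟨
      x * u * ((x * u) ^ k * (u ^ tri k * b)) ∎

    inner : ∀ k l → e (suc k) (suc l) ≈ x * u * g k (suc l) + g (suc k) l
    inner k l = begin
      x ^ suc k * (u ^ tri (suc k) * (B k (suc l) + u ^ suc k * B (suc k) l))
        ≈⟨ solve 5 (λ x t b v c → x :* (t :* (b :+ v :* c)) := x :* (t :* b) :+ (x :* v) :* (t :* c))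
             refl _ _ _ _ _ ⟩
      x ^ suc k * (u ^ tri (suc k) * B k (suc l)) +
      x ^ suc k * u ^ suc k * (u ^ tri (suc k) * B (suc k) l)
        ≈⟨ +-cong (shift k _) (*-congʳ (sym (^-distrib-* x u (suc k)))) ⟩
      x * u * g k (suc l) + g (suc k) l ∎

    edge-k : ∀ k → e (suc k) 0 ≈ x * u * g k 0
    edge-k k = trans (*-congˡ (*-congˡ (sym (B-zeroʳ k)))) (shift k _)

    edge-l : ∀ l → e 0 (suc l) ≈ g 0 l
    edge-l l = refl

  -- Induction on b from the q-binomial theorem: in the factor z + u^b, z raises k and u^b raises
  -- the exponent of u, and `tri∸-step` reconciles the two with Pascal's rule. Writing z + u^j in
  -- place of 1 + z⁻¹ u^j avoids inverting z.
  finite-triple-product : ∀ z a b →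
    Π (λ i → 1# + z * u ^ suc i) a * Π (λ j → z + u ^ j) b ≈
    diag (λ k l → z ^ k * (u ^ tri∸ k b * B k l)) (b ℕ.+ a)
  finite-triple-product z a zero    = trans (*-identityʳ _) (q-binomial-theorem z a)
  finite-triple-product z a (suc b) = begin
    P * (Π (λ j → z + u ^ j) b * (z + u ^ b))
      ≈⟨ *-assoc _ _ _ ⟨
    P * Π (λ j → z + u ^ j) b * (z + u ^ b)
      ≈⟨ *-congʳ (finite-triple-product z a b) ⟩
    diag c n * (z + u ^ b)
      ≈⟨ solve 3 (λ d z v → d :* (z :+ v) := z :* d :+ v :* d) refl _ _ _ ⟩
    z * diag c n + u ^ b * diag c n
      ≈⟨ +-cong (diag-*ˡ _ c n) (diag-*ˡ _ c n) ⟩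
    diag (λ k l → z * c k l) n + diag (λ k l → u ^ b * c k l) n
      ≈⟨ diag-pascal e _ _ inner edge-k edge-l n ⟨
    diag e (suc n) ∎
    where
    n : ℕ
    n = b ℕ.+ a

    P : Carrier
    P = Π (λ i → 1# + z * u ^ suc i) a

    c e : ℕ → ℕ → Carrier
    c k l = z ^ k * (u ^ tri∸ k b * B k l)
    e k l = z ^ k * (u ^ tri∸ k (suc b) * B k l)

    inner : ∀ k l → e (suc k) (suc l) ≈ z * c k (suc l) + u ^ b * c (suc k) l
    inner k l = begin
      z * z ^ k * (u ^ tri∸ k b * (B k (suc l) + u ^ suc k * B (suc k) l))
        ≈⟨ solve 6 (λ z y t b v c → (z :* y) :* (t :* (b :+ v :* c))
             := z :* (y :* (t :* b)) :+ (z :* y) :* ((t :* v) :* c)) refl _ _ _ _ _ _ ⟩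
      z * c k (suc l) + z ^ suc k * (u ^ tri∸ k b * u ^ suc k * B (suc k) l)
        ≈⟨ +-congˡ (*-congˡ (*-congʳ (trans (sym (^-homo-* u (tri∸ k b) (suc k)))
             (trans (reflexive (≡.cong (u ^_) (≡.sym (tri∸-step k b))))
                    (^-homo-* u b (tri∸ (suc k) b)))))) ⟩
      z * c k (suc l) + z ^ suc k * (u ^ b * u ^ tri∸ (suc k) b * B (suc k) l)
        ≈⟨ +-congˡ (solve 4 (λ y v t c → y :* ((v :* t) :* c) := v :* (y :* (t :* c))) refl _ _ _ _) ⟩
      z * c k (suc l) + u ^ b * c (suc k) l ∎

    edge-k : ∀ k → e (suc k) 0 ≈ z * c k 0
    edge-k k = trans (*-assoc _ _ _) (*-congˡ (*-congˡ (*-congˡ (sym (B-zeroʳ k)))))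

    edge-l : ∀ l → e 0 (suc l) ≈ u ^ b * c 0 l
    edge-l l = begin
      1# * (u ^ tri∸ 0 (suc b) * 1#)
        ≈⟨ *-congˡ (*-congʳ (trans (reflexive (≡.cong (u ^_) (tri∸-zero b)))
             (^-homo-* u b (tri∸ 0 b)))) ⟩
      1# * (u ^ b * u ^ tri∸ 0 b * 1#)
        ≈⟨ solve 2 (λ v t → con 1 :* ((v :* t) :* con 1) := v :* (con 1 :* (t :* con 1))) refl _ _ ⟩
      u ^ b * (1# * (u ^ tri∸ 0 b * 1#)) ∎

-- Roots of unity of odd prime order

tri-odd : ∀ h → tri (suc (h ℕ.+ h)) ≡ suc h ℕ.* suc (h ℕ.+ h)
tri-odd zero    = ≡.refl
tri-odd (suc h) rewrite ℕₚ.+-suc h h | tri-odd h =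
  solve 1 (λ h → con 3 :+ (h :+ h) :+ (con 2 :+ (h :+ h) :+ (con 1 :+ h) :* (con 1 :+ (h :+ h)))
    := (con 2 :+ h) :* (con 3 :+ (h :+ h))) ≡.refl h
  where open ℕ-Solver

odd-prime⇒coprime-4 : ∀ h → Prime (suc (h ℕ.+ h)) → Coprime 4 (suc (h ℕ.+ h))
odd-prime⇒coprime-4 h p (d∣4 , d∣ℓ) with prime⇒irreducible p d∣ℓ
... | inj₁ d≡1    = d≡1
... | inj₂ ≡.refl = ⊥-elim (ℓ∤4 h p d∣4)
  where
  ℓ∤4 : ∀ h → Prime (suc (h ℕ.+ h)) → ¬ (suc (h ℕ.+ h) ∣ 4)
  ℓ∤4 zero          p _   = ¬prime[1] p
  ℓ∤4 (suc zero)    _ 3∣4 = from-no (3 ℕ∣.∣? 4) 3∣4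
  ℓ∤4 (suc (suc h)) _ ℓ∣4 =
    ℕₚ.<⇒≱ (ℕ.s≤s (ℕₚ.+-mono-≤ 2≤2+h 2≤2+h)) (ℕ∣.∣⇒≤ ℓ∣4)
    where
    2≤2+h : 2 ℕ.≤ suc (suc h)
    2≤2+h = ℕ.s≤s (ℕ.s≤s ℕ.z≤n)

odd+even : ∀ i j → suc (j ℕ.+ j) ℕ.+ suc (suc (i ℕ.+ i)) ≡ suc (suc (i ℕ.+ j) ℕ.+ suc (i ℕ.+ j))
odd+even = solve 2 (λ i j → con 1 :+ (j :+ j) :+ (con 2 :+ (i :+ i)) :=
  con 1 :+ ((con 1 :+ (i :+ j)) :+ (con 1 :+ (i :+ j)))) ≡.refl
  where open ℕ-Solver

-- The only assumption on ζ is [ℓ] = 1 + ζ + … + ζ^(ℓ−1) = 0: the ring need not be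
-- a domain, so identities between roots are derived from q-binomials rather than
-- by counting roots.
module OddPrimeRootOfUnity
  (R : CommutativeRing 0ℓ 0ℓ) (ζ : CommutativeRing.Carrier R)
  (h : ℕ) (ℓ-prime : Prime (suc (h ℕ.+ h)))
  ([ℓ]≈0 : CommutativeRing._≈_ R (QBinomial.[_] R ζ (suc (h ℕ.+ h))) (CommutativeRing.0# R))
  where

  open CommutativeRing R hiding (zero)
  open SumsAndProducts R
  open QBinomial R ζ
  open import Algebra.Properties.CommutativeSemiring.Exp commutativeSemiring
    using (_^_; ^-homo-*; ^-congʳ)
  open import Algebra.Properties.Ring ring using (-‿distribʳ-*; -‿involutive; +-inverseʳ-unique)
  open import Algebra.Solver.Ring.NaturalCoefficients.Default commutativeSemiring
    using (solve; _:+_; _:*_; _:=_; con)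
  open import Relation.Binary.Reasoning.Setoid setoid

  private
    ℓ : ℕ
    ℓ = suc (h ℕ.+ h)

  -- Splitting [ℓ + 1] at its last or at its first term leaves a multiple of [ℓ] and, respectively,
  -- ζ^ℓ or 1.
  ζ^ℓ≈1 : ζ ^ ℓ ≈ 1#
  ζ^ℓ≈1 = begin
    ζ ^ ℓ                      ≈⟨ solve 2 (λ z w → w := con 0 :+ w :* (con 1 :+ z :* con 0)) refl ζ _ ⟩
    0# + ζ ^ ℓ * [ 1 ]         ≈⟨ +-congʳ [ℓ]≈0 ⟨
    [ ℓ ] + ζ ^ ℓ * [ 1 ]      ≈⟨ [+] ℓ 1 ⟨
    [ ℓ ℕ.+ 1 ]                ≡⟨ ≡.cong [_] (ℕₚ.+-comm ℓ 1) ⟩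
    1# + ζ * [ ℓ ]             ≈⟨ +-congˡ (*-congˡ [ℓ]≈0) ⟩
    1# + ζ * 0#                ≈⟨ solve 1 (λ z → con 1 :+ z :* con 0 := con 1) refl ζ ⟩
    1#                         ∎

  [tℓ]≈0 : ∀ t → [ t ℕ.* ℓ ] ≈ 0#
  [tℓ]≈0 zero    = refl
  [tℓ]≈0 (suc t) = begin
    [ ℓ ℕ.+ t ℕ.* ℓ ]             ≈⟨ [+] ℓ (t ℕ.* ℓ) ⟩
    [ ℓ ] + ζ ^ ℓ * [ t ℕ.* ℓ ]   ≈⟨ +-cong [ℓ]≈0 (*-congˡ ([tℓ]≈0 t)) ⟩
    0# + ζ ^ ℓ * 0#               ≈⟨ solve 1 (λ z → con 0 :+ z :* con 0 := con 0) refl _ ⟩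
    0#                            ∎

  [k]∣[sk] : ∀ k s → ∃ λ w → [ k ] * w ≈ [ s ℕ.* k ]
  [k]∣[sk] k zero    = 0# , zeroʳ _
  [k]∣[sk] k (suc s) with [k]∣[sk] k s
  ... | w , kw≈sk = 1# + ζ ^ k * w , (begin
    [ k ] * (1# + ζ ^ k * w)
      ≈⟨ solve 3 (λ x v w → x :* (con 1 :+ v :* w) := x :+ v :* (x :* w)) refl _ _ _ ⟩
    [ k ] + ζ ^ k * ([ k ] * w)
      ≈⟨ +-congˡ (*-congˡ kw≈sk) ⟩
    [ k ] + ζ ^ k * [ s ℕ.* k ]
      ≈⟨ [+] k (s ℕ.* k) ⟨
    [ k ℕ.+ s ℕ.* k ] ∎)

  -- By Bézout some multiple x k is 1 above or 1 below a multiple of ℓ, and [k] divides [x k]. In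
  -- the first case [x k] = 1; in the second 1 + ζ [x k] = 0, hence the inverse - ζ w.
  coprime⇒unit : ∀ {k} → Coprime k ℓ → ∃ λ w → [ k ] * w ≈ 1#
  coprime⇒unit {k} c with coprime-Bézout c
  ... | Bézout.+- x y 1+yℓ≡xk with [k]∣[sk] k x
  ...   | w , kw≈xk = w , (begin
    [ k ] * w            ≈⟨ kw≈xk ⟩
    [ x ℕ.* k ]          ≡⟨ ≡.cong [_] 1+yℓ≡xk ⟨
    1# + ζ * [ y ℕ.* ℓ ] ≈⟨ +-congˡ (*-congˡ ([tℓ]≈0 y)) ⟩
    1# + ζ * 0#          ≈⟨ solve 1 (λ z → con 1 :+ z :* con 0 := con 1) refl ζ ⟩
    1#                   ∎)
  coprime⇒unit {k} c | Bézout.-+ x y 1+xk≡yℓ with [k]∣[sk] k x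
  ...   | w , kw≈xk = - (ζ * w) , (begin
    [ k ] * - (ζ * w)    ≈⟨ -‿distribʳ-* _ _ ⟨
    - ([ k ] * (ζ * w))  ≈⟨ -‿cong (solve 3 (λ k z w → k :* (z :* w) := z :* (k :* w)) refl _ _ _) ⟩
    - (ζ * ([ k ] * w))  ≈⟨ -‿cong (*-congˡ kw≈xk) ⟩
    - (ζ * [ x ℕ.* k ])  ≈⟨ -‿cong (+-inverseʳ-unique _ _
                              (trans (reflexive (≡.cong [_] 1+xk≡yℓ)) ([tℓ]≈0 y))) ⟩
    - (- 1#)             ≈⟨ -‿involutive 1# ⟩
    1#                   ∎)

  -- Here [4] = (1 + ζ)(1 + ζ²) is a unit, so its factor is one too. For z = ζ² this is the 1 + z to
  -- be removed from the triple product.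
  1+ζ²-unit : ∃ λ w → (1# + ζ * ζ) * w ≈ 1#
  1+ζ²-unit with coprime⇒unit (odd-prime⇒coprime-4 h ℓ-prime)
  ... | w , 4w≈1 = (1# + ζ) * w , trans
    (solve 2 (λ z w → (con 1 :+ z :* z) :* ((con 1 :+ z) :* w) :=
       (con 1 :+ z :* (con 1 :+ z :* (con 1 :+ z :* (con 1 :+ z :* con 0)))) :* w) refl ζ w)
    4w≈1

  -- The analogue of ℓ dividing its inner binomial coefficients: [k + 1] times the left side is a
  -- multiple of [ℓ], and [k + 1] is a unit as ℓ is prime.
  B≈0 : ∀ k l → suc k ℕ.+ suc l ≡ ℓ → B (suc k) (suc l) ≈ 0#
  B≈0 k l k+l≡ℓ with coprime⇒unit {suc k} (Coprimality.sym
    (prime⇒coprime ℓ-prime (≡.subst (suc k ℕ.<_) k+l≡ℓ (ℕₚ.m<m+n (suc k) (ℕ.s≤s ℕ.z≤n)))))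
  ... | w , kw≈1 = begin
    B (suc k) (suc l)                    ≈⟨ *-identityˡ _ ⟨
    1# * B (suc k) (suc l)               ≈⟨ *-congʳ kw≈1 ⟨
    [ suc k ] * w * B (suc k) (suc l)    ≈⟨ solve 3 (λ x w b → (x :* w) :* b := w :* (x :* b)) refl _ _ _ ⟩
    w * ([ suc k ] * B (suc k) (suc l))  ≈⟨ *-congˡ ([1+k]*B k (suc l)) ⟩
    w * ([ suc k ℕ.+ suc l ] * B k (suc l))
      ≈⟨ *-congˡ (*-congʳ (trans (reflexive (≡.cong [_] k+l≡ℓ)) [ℓ]≈0)) ⟩
    w * (0# * B k (suc l))               ≈⟨ solve 2 (λ w b → w :* (con 0 :* b) := con 0) refl _ _ ⟩
    0#                                   ∎

  ζ^tℓ≈1 : ∀ t → ζ ^ (t ℕ.* ℓ) ≈ 1#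
  ζ^tℓ≈1 zero    = refl
  ζ^tℓ≈1 (suc t) = trans (^-homo-* ζ ℓ (t ℕ.* ℓ)) (trans (*-cong ζ^ℓ≈1 (ζ^tℓ≈1 t)) (*-identityˡ 1#))

  -- In the q-binomial theorem only the two end terms survive, and the last has ζ^(tri ℓ) = 1,
  -- because tri ℓ = (h + 1) ℓ.
  roots-product : ∀ x → Π (λ i → 1# + x * ζ ^ suc i) ℓ ≈ 1# + x ^ ℓ
  roots-product x = trans (q-binomial-theorem x ℓ) (ends h ≡.refl)
    where
    f : ℕ → ℕ → Carrier
    f k l = x ^ k * (ζ ^ tri k * B k l)

    -- Splitting h makes room to peel off both end terms; h = 0 would mean ℓ = 1.
    ends : ∀ h′ → h ≡ h′ → diag f (suc (h′ ℕ.+ h′)) ≈ 1# + x ^ suc (h′ ℕ.+ h′)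
    ends zero     ≡.refl = ⊥-elim (¬prime[1] ℓ-prime)
    ends (suc h′) ≡.refl = begin
      f 0 ℓ + diag (λ k l → f (suc k) l) (h ℕ.+ h)
        ≈⟨ +-congˡ (diag-last (λ k l → f (suc k) l) (h′ ℕ.+ h)) ⟩
      f 0 ℓ + (diag (λ k l → f (suc k) (suc l)) (h′ ℕ.+ h) + f ℓ 0)
        ≈⟨ +-cong (solve 0 (con 1 :* (con 1 :* con 1) := con 1) refl)
             (+-cong (diag≈0 (h′ ℕ.+ h) inner≈0)
               (*-congˡ (*-congʳ (trans (^-congʳ ζ (tri-odd h)) (ζ^tℓ≈1 (suc h)))))) ⟩
      1# + (0# + x ^ ℓ * (1# * 1#))
        ≈⟨ solve 1 (λ y → con 1 :+ (con 0 :+ y :* (con 1 :* con 1)) := con 1 :+ y) refl _ ⟩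
      1# + x ^ ℓ ∎
      where
      inner≈0 : ∀ k l → k ℕ.+ l ≡ h′ ℕ.+ h → f (suc k) (suc l) ≈ 0#
      inner≈0 k l e = begin
        x ^ suc k * (ζ ^ tri (suc k) * B (suc k) (suc l))
          ≈⟨ *-congˡ (*-congˡ (B≈0 k l
               (≡.cong suc (≡.trans (ℕₚ.+-suc k l) (≡.cong suc e))))) ⟩
        x ^ suc k * (ζ ^ tri (suc k) * 0#)
          ≈⟨ solve 2 (λ y t → y :* (t :* con 0) := con 0) refl _ _ ⟩
        0# ∎

  -- Here `ε a` stands for ζ^(-a). If i + j + 1 = h, the exponents 2 i + 2 and 2 j + 1 add up to ℓ,
  -- so the even powers of ζ, in reverse order, are the inverses of the odd ones. The factor 1 + x
  -- belongs to ζ^ℓ = 1.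
  symmetric-roots-product : (ε : ℕ → Carrier) → (∀ a → ε a * ζ ^ a ≈ 1#) → ∀ x →
    (1# + x) * Π (λ i → (1# + x * ζ ^ suc (i ℕ.+ i)) * (1# + x * ε (suc (i ℕ.+ i)))) h ≈ 1# + x ^ ℓ
  symmetric-roots-product ε ε-inverse x = begin
    (1# + x) * Π (λ i → odd i * odd⁻¹ i) h
      ≈⟨ *-cong (+-congˡ (trans (sym (*-identityʳ x)) (*-congˡ (sym ζ^ℓ≈1)))) (Π-* odd odd⁻¹ h) ⟩
    F (h ℕ.+ h) * (Π odd h * Π odd⁻¹ h)
      ≈⟨ *-congˡ (*-congˡ (Π-reverse (λ i → F (suc (i ℕ.+ i))) odd⁻¹ h even≈odd⁻¹)) ⟨
    F (h ℕ.+ h) * (Π odd h * Π (λ i → F (suc (i ℕ.+ i))) h)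
      ≈⟨ *-congˡ (Π-even-odd F h) ⟨
    F (h ℕ.+ h) * Π F (h ℕ.+ h)
      ≈⟨ *-comm _ _ ⟩
    Π F ℓ
      ≈⟨ roots-product x ⟩
    1# + x ^ ℓ ∎
    where
    F odd odd⁻¹ : ℕ → Carrier
    F i     = 1# + x * ζ ^ suc i
    odd i   = F (i ℕ.+ i)
    odd⁻¹ i = 1# + x * ε (suc (i ℕ.+ i))

    even≈odd⁻¹ : ∀ i j → suc (i ℕ.+ j) ≡ h → F (suc (i ℕ.+ i)) ≈ odd⁻¹ j
    even≈odd⁻¹ i j ≡.refl = +-congˡ (*-congˡ (begin
      ζ ^ b                 ≈⟨ *-identityˡ _ ⟨
      1# * ζ ^ b            ≈⟨ *-congʳ (ε-inverse a) ⟨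
      ε a * ζ ^ a * ζ ^ b   ≈⟨ *-assoc _ _ _ ⟩
      ε a * (ζ ^ a * ζ ^ b) ≈⟨ *-congˡ (^-homo-* ζ a b) ⟨
      ε a * ζ ^ (a ℕ.+ b)   ≈⟨ *-congˡ (trans (^-congʳ ζ (odd+even i j)) ζ^ℓ≈1) ⟩
      ε a * 1#              ≈⟨ *-identityʳ _ ⟩
      ε a                   ∎))
      where
      a b : ℕ
      a = suc (j ℕ.+ j)
      b = suc (suc (i ℕ.+ i))

-- Formal power series and the supports of their products

module PowerSeries (R : CommutativeRing 0ℓ 0ℓ) where

  open CommutativeRing R hiding (zero)
  open SumsAndProducts R using (diag; diag-cong; diag-+; diag-*ˡ; diag-last; diag-flip)
  open SeriesOps 0# 1# _+_ _*_
  open import Algebra.Properties.Ring ring using (-0#≈0#)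
  open import Algebra.Solver.Ring.NaturalCoefficients.Default commutativeSemiring
    using (solve; _:+_; _:*_; _:=_; con)
  open import Relation.Binary.Reasoning.Setoid setoid

  infix 4 _≈S_
  _≈S_ : Series → Series → Set
  f ≈S g = ∀ i → f i ≈ g i

  _+S_ : Series → Series → Series
  (f +S g) i = f i + g i

  -S_ : Series → Series
  (-S f) i = - f i

  zeroS : Series
  zeroS _ = 0#

  tail : Series → Series
  tail f i = f (suc i)

  sumTo-cong : ∀ {f g} n → (∀ i → i ℕ.≤ n → f i ≈ g i) → sumTo f n ≈ sumTo g n
  sumTo-cong zero    f≈g = f≈g 0 ℕ.z≤n
  sumTo-cong (suc n) f≈g =
    +-cong (sumTo-cong n λ i i≤n → f≈g i (ℕₚ.m≤n⇒m≤1+n i≤n)) (f≈g (suc n) ℕₚ.≤-refl)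

  sumTo-diag : ∀ (f : ℕ → ℕ → Carrier) n → sumTo (λ i → f i (n ℕ.∸ i)) n ≈ diag f n
  sumTo-diag f zero    = refl
  sumTo-diag f (suc n) = begin
    sumTo (λ i → f i (suc n ℕ.∸ i)) n + f (suc n) (n ℕ.∸ n)
      ≈⟨ +-cong
           (sumTo-cong n λ i i≤n → reflexive (≡.cong (f i) (ℕₚ.+-∸-assoc 1 i≤n)))
           (reflexive (≡.cong (f (suc n)) (ℕₚ.n∸n≡0 n))) ⟩
    sumTo (λ i → f i (suc (n ℕ.∸ i))) n + f (suc n) 0
      ≈⟨ +-congʳ (sumTo-diag (λ k l → f k (suc l)) n) ⟩
    diag (λ k l → f k (suc l)) n + f (suc n) 0
      ≈⟨ diag-last f n ⟨
    diag f (suc n) ∎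

  *S-diag : ∀ f g n → (f *S g) n ≈ diag (λ i j → f i * g j) n
  *S-diag f g = sumTo-diag (λ i j → f i * g j)

  *S-suc : ∀ f g n → (f *S g) (suc n) ≈ f 0 * g (suc n) + (tail f *S g) n
  *S-suc f g n = trans (*S-diag f g (suc n)) (+-congˡ (sym (*S-diag (tail f) g n)))

  *S-cong : ∀ {f f′ g g′} → f ≈S f′ → g ≈S g′ → (f *S g) ≈S (f′ *S g′)
  *S-cong f≈f′ g≈g′ n = sumTo-cong n λ i _ → *-cong (f≈f′ i) (g≈g′ (n ℕ.∸ i))

  *S-congʳ : ∀ {f f′} g → f ≈S f′ → (f *S g) ≈S (f′ *S g)
  *S-congʳ g f≈f′ = *S-cong f≈f′ (λ i → refl {g i})

  *S-comm : ∀ f g → (f *S g) ≈S (g *S f)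
  *S-comm f g n = begin
    (f *S g) n                     ≈⟨ *S-diag f g n ⟩
    diag (λ i j → f i * g j) n     ≈⟨ diag-flip _ n ⟩
    diag (λ i j → f j * g i) n     ≈⟨ diag-cong n (λ i j _ → *-comm (f j) (g i)) ⟩
    diag (λ i j → g i * f j) n     ≈⟨ *S-diag g f n ⟨
    (g *S f) n                     ∎

  *S-distribʳ : ∀ h f g → ((f +S g) *S h) ≈S ((f *S h) +S (g *S h))
  *S-distribʳ h f g n = begin
    ((f +S g) *S h) n                                         ≈⟨ *S-diag (f +S g) h n ⟩
    diag (λ i j → (f i + g i) * h j) n                        ≈⟨ diag-cong n (λ i j _ → distribʳ (h j) (f i) (g i)) ⟩
    diag (λ i j → f i * h j + g i * h j) n                    ≈⟨ diag-+ _ _ n ⟩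
    diag (λ i j → f i * h j) n + diag (λ i j → g i * h j) n   ≈⟨ +-cong (*S-diag f h n) (*S-diag g h n) ⟨
    (f *S h) n + (g *S h) n                                   ∎

  *S-distribˡ : ∀ h f g → (h *S (f +S g)) ≈S ((h *S f) +S (h *S g))
  *S-distribˡ h f g n = trans (*S-comm h (f +S g) n)
    (trans (*S-distribʳ h f g n) (+-cong (*S-comm f h n) (*S-comm g h n)))

  scalar-*S : ∀ x f g n → ((λ i → x * f i) *S g) n ≈ x * (f *S g) n
  scalar-*S x f g n = begin
    ((λ i → x * f i) *S g) n          ≈⟨ *S-diag _ g n ⟩
    diag (λ i j → x * f i * g j) n    ≈⟨ diag-cong n (λ i j _ → *-assoc x (f i) (g j)) ⟩
    diag (λ i j → x * (f i * g j)) n  ≈⟨ diag-*ˡ x _ n ⟨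
    x * diag (λ i j → f i * g j) n    ≈⟨ *-congˡ (*S-diag f g n) ⟨
    x * (f *S g) n                    ∎

  *S-zeroˡ : ∀ f → (zeroS *S f) ≈S zeroS
  *S-zeroˡ f zero    = zeroˡ (f 0)
  *S-zeroˡ f (suc n) = trans (*S-suc zeroS f n)
    (trans (+-cong (zeroˡ (f (suc n))) (*S-zeroˡ f n)) (+-identityˡ 0#))

  constant : Carrier → Series
  constant x zero    = x
  constant x (suc _) = 0#

  constant-*S : ∀ x f n → (constant x *S f) n ≈ x * f n
  constant-*S x f zero    = refl
  constant-*S x f (suc n) = trans (*S-suc (constant x) f n)
    (trans (+-congˡ (*S-zeroˡ f n)) (+-identityʳ _))

  oneS≈constant : oneS ≈S constant 1#
  oneS≈constant zero    = refl
  oneS≈constant (suc _) = refl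

  *S-identityˡ : ∀ f → (oneS *S f) ≈S f
  *S-identityˡ f n = begin
    (oneS *S f) n         ≈⟨ *S-congʳ f oneS≈constant n ⟩
    (constant 1# *S f) n  ≈⟨ constant-*S 1# f n ⟩
    1# * f n              ≈⟨ *-identityˡ (f n) ⟩
    f n                   ∎

  *S-assoc : ∀ f g h → ((f *S g) *S h) ≈S (f *S (g *S h))
  *S-assoc f g h zero    = *-assoc (f 0) (g 0) (h 0)
  *S-assoc f g h (suc n) = begin
    ((f *S g) *S h) (suc n)
      ≈⟨ *S-suc (f *S g) h n ⟩
    f 0 * g 0 * h (suc n) + (tail (f *S g) *S h) n
      ≈⟨ +-congˡ (*S-congʳ h (*S-suc f g) n) ⟩
    f 0 * g 0 * h (suc n) + (((λ i → f 0 * tail g i) +S (tail f *S g)) *S h) n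
      ≈⟨ +-congˡ (*S-distribʳ h _ _ n) ⟩
    f 0 * g 0 * h (suc n) + (((λ i → f 0 * tail g i) *S h) n + ((tail f *S g) *S h) n)
      ≈⟨ +-congˡ (+-cong (scalar-*S (f 0) (tail g) h n) (*S-assoc (tail f) g h n)) ⟩
    f 0 * g 0 * h (suc n) + (f 0 * (tail g *S h) n + (tail f *S (g *S h)) n)
      ≈⟨ solve 5 (λ a b c d e → (a :* b) :* c :+ (a :* d :+ e) := a :* (b :* c :+ d) :+ e) refl _ _ _ _ _ ⟩
    f 0 * (g 0 * h (suc n) + (tail g *S h) n) + (tail f *S (g *S h)) n
      ≈⟨ +-congʳ (*-congˡ (*S-suc g h n)) ⟨
    f 0 * (g *S h) (suc n) + (tail f *S (g *S h)) n
      ≈⟨ *S-suc f (g *S h) n ⟨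
    (f *S (g *S h)) (suc n) ∎

  seriesRing : CommutativeRing 0ℓ 0ℓ
  seriesRing = record
    { Carrier = Series ; _≈_ = _≈S_ ; _+_ = _+S_ ; _*_ = _*S_ ; -_ = -S_ ; 0# = zeroS ; 1# = oneS
    ; isCommutativeRing = record
      { isRing = record
        { +-isAbelianGroup = record
          { isGroup = record
            { isMonoid = record
              { isSemigroup = record
                { isMagma = record
                  { isEquivalence = record
                    { refl  = λ _ → refl
                    ; sym   = λ f≈g i → sym (f≈g i)
                    ; trans = λ f≈g g≈h i → trans (f≈g i) (g≈h i)
                    }
                  ; ∙-cong = λ f≈f′ g≈g′ i → +-cong (f≈f′ i) (g≈g′ i)
                  }
                ; assoc = λ f g h i → +-assoc (f i) (g i) (h i)
                }
              ; identity = (λ f i → +-identityˡ (f i)) , (λ f i → +-identityʳ (f i))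
              }
            ; inverse = (λ f i → -‿inverseˡ (f i)) , (λ f i → -‿inverseʳ (f i))
            ; ⁻¹-cong = λ f≈g i → -‿cong (f≈g i)
            }
          ; comm = λ f g i → +-comm (f i) (g i)
          }
        ; *-cong = *S-cong
        ; *-assoc = *S-assoc
        ; *-identity = *S-identityˡ , λ f i → trans (*S-comm f oneS i) (*S-identityˡ f i)
        ; distrib = *S-distribˡ , *S-distribʳ
        }
      ; *-comm = *S-comm
      }
    }

  module S = CommutativeRing seriesRing
  module SΠ = SumsAndProducts seriesRing
  open import Algebra.Properties.Semiring.Exp S.semiring using () renaming (_^_ to _^S_)
  open import Algebra.Properties.Semiring.Exp semiring using (_^_)

  constant-cong : ∀ {x y} → x ≈ y → constant x ≈S constant y
  constant-cong x≈y zero    = x≈y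
  constant-cong x≈y (suc _) = refl

  constant-+ : ∀ x y → constant (x + y) ≈S (constant x +S constant y)
  constant-+ x y zero    = refl
  constant-+ x y (suc _) = sym (+-identityˡ 0#)

  constant-* : ∀ x y → constant (x * y) ≈S (constant x *S constant y)
  constant-* x y zero    = refl
  constant-* x y (suc n) = sym (trans (constant-*S x (constant y) (suc n)) (zeroʳ x))

  constant-^ : ∀ x n → constant (x ^ n) ≈S (constant x ^S n)
  constant-^ x zero    i = sym (oneS≈constant i)
  constant-^ x (suc n) = S.trans (constant-* x (x ^ n)) (S.*-congˡ {constant x} (constant-^ x n))

  constant-- : ∀ x → constant (- x) ≈S (-S constant x)
  constant-- x zero    = refl
  constant-- x (suc _) = sym -0#≈0#

  q : Series
  q zero          = 0#
  q (suc zero)    = 1#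
  q (suc (suc _)) = 0#

  q-*S-zero : ∀ f → (q *S f) 0 ≈ 0#
  q-*S-zero f = zeroˡ (f 0)

  q-*S-suc : ∀ f n → (q *S f) (suc n) ≈ f n
  q-*S-suc f n = begin
    (q *S f) (suc n)                 ≈⟨ *S-suc q f n ⟩
    0# * f (suc n) + (tail q *S f) n ≈⟨ +-cong (zeroˡ _) (*S-congʳ f tail-q n) ⟩
    0# + (oneS *S f) n               ≈⟨ +-identityˡ _ ⟩
    (oneS *S f) n                    ≈⟨ *S-identityˡ f n ⟩
    f n                              ∎
    where
    tail-q : tail q ≈S oneS
    tail-q zero    = refl
    tail-q (suc _) = refl

  q^-*S-< : ∀ k f n → n ℕ.< k → ((q ^S k) *S f) n ≈ 0#
  q^-*S-< (suc k) f zero    _ = trans (*S-assoc q (q ^S k) f 0) (q-*S-zero ((q ^S k) *S f))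
  q^-*S-< (suc k) f (suc n) (ℕ.s≤s n<k) = trans (*S-assoc q (q ^S k) f (suc n))
    (trans (q-*S-suc ((q ^S k) *S f) n) (q^-*S-< k f n n<k))

  q^-*S-+ : ∀ k f n → ((q ^S k) *S f) (k ℕ.+ n) ≈ f n
  q^-*S-+ zero    f n = *S-identityˡ f n
  q^-*S-+ (suc k) f n = trans (*S-assoc q (q ^S k) f (suc (k ℕ.+ n)))
    (trans (q-*S-suc ((q ^S k) *S f) (k ℕ.+ n)) (q^-*S-+ k f n))

  q^-coeff : ∀ k n → (q ^S k) n ≈ (if ⌊ n ℕ.≟ k ⌋ then 1# else 0#)
  q^-coeff zero    zero    = refl
  q^-coeff zero    (suc n) = refl
  q^-coeff (suc k) zero    = q-*S-zero (q ^S k)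
  q^-coeff (suc k) (suc n) = trans (q-*S-suc (q ^S k) n) (trans (q^-coeff k n) (same k n))
    where
    same : ∀ k n → (if ⌊ n ℕ.≟ k ⌋ then 1# else 0#) ≈ (if ⌊ suc n ℕ.≟ suc k ⌋ then 1# else 0#)
    same k n with n ℕ.≟ k | suc n ℕ.≟ suc k
    ... | yes _   | yes _ = refl
    ... | no  _   | no  _ = refl
    ... | yes n≡k | no n≢k = ⊥-elim (n≢k (≡.cong suc n≡k))
    ... | no  n≢k | yes n≡k = ⊥-elim (n≢k (ℕₚ.suc-injective n≡k))

  onePlus≈ : ∀ x n → onePlus x n ≈S (oneS +S (constant x *S (q ^S suc n)))
  onePlus≈ x n zero = sym (begin
    1# + x * (0# * (q ^S n) 0)  ≈⟨ solve 2 (λ x y → con 1 :+ x :* (con 0 :* y) := con 1) refl x _ ⟩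
    1#                          ∎)
  onePlus≈ x n (suc i) = sym (begin
    0# + (constant x *S (q ^S suc n)) (suc i)
      ≈⟨ +-identityˡ _ ⟩
    (constant x *S (q ^S suc n)) (suc i)
      ≈⟨ constant-*S x (q ^S suc n) (suc i) ⟩
    x * (q ^S suc n) (suc i)
      ≈⟨ *-congˡ (trans (q-*S-suc (q ^S n) i) (q^-coeff n i)) ⟩
    x * (if ⌊ i ℕ.≟ n ⌋ then 1# else 0#)
      ≈⟨ scale ⟩
    (if ⌊ i ℕ.≟ n ⌋ then x else 0#) ∎)
    where
    scale : x * (if ⌊ i ℕ.≟ n ⌋ then 1# else 0#) ≈ (if ⌊ i ℕ.≟ n ⌋ then x else 0#)
    scale with i ℕ.≟ n
    ... | yes _ = *-identityʳ x
    ... | no  _ = zeroʳ x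

  -- Checked by coefficients: below q^(n+1) only the constant term is seen, and lowering an index by
  -- n + 1 keeps the remainder and takes one from the quotient.
  geom-unfold : ∀ x n → geom x n ≈S (oneS +S (constant x *S ((q ^S suc n) *S geom x n)))
  geom-unfold x n i with i ℕ.<? suc n
  geom-unfold x n zero    | yes _ = sym (begin
    1# + x * (0# * (q ^S n) 0 * 1#)
      ≈⟨ solve 2 (λ x y → con 1 :+ x :* ((con 0 :* y) :* con 1) := con 1) refl x _ ⟩
    1# ∎)
  geom-unfold x n (suc i) | yes i<n rewrite m<n⇒m%n≡m i<n = sym (begin
    0# + (constant x *S ((q ^S suc n) *S geom x n)) (suc i)
      ≈⟨ +-congˡ (constant-*S x ((q ^S suc n) *S geom x n) (suc i)) ⟩
    0# + x * ((q ^S suc n) *S geom x n) (suc i)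
      ≈⟨ +-congˡ (*-congˡ (q^-*S-< (suc n) (geom x n) (suc i) i<n)) ⟩
    0# + x * 0#
      ≈⟨ solve 1 (λ x → con 0 :+ x :* con 0 := con 0) refl x ⟩
    0# ∎)
  geom-unfold x n i | no i≮n with ℕₚ.m≤n⇒∃[o]m+o≡n (ℕₚ.≮⇒≥ i≮n)
  ... | j , ≡.refl = sym (begin
    0# + (constant x *S ((q ^S suc n) *S geom x n)) (suc (n ℕ.+ j))
      ≈⟨ +-congˡ (constant-*S x ((q ^S suc n) *S geom x n) (suc (n ℕ.+ j))) ⟩
    0# + x * ((q ^S suc n) *S geom x n) (suc n ℕ.+ j)
      ≈⟨ +-identityˡ _ ⟩
    x * ((q ^S suc n) *S geom x n) (suc n ℕ.+ j)
      ≈⟨ *-congˡ (q^-*S-+ (suc n) (geom x n) j) ⟩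
    x * geom x n j
      ≈⟨ shift ⟩
    geom x n (suc n ℕ.+ j) ∎)
    where
    n+j%n : (suc n ℕ.+ j) % suc n ≡ j % suc n
    n+j%n = ≡.trans (≡.cong (_% suc n) (ℕₚ.+-comm (suc n) j)) ([m+n]%n≡m%n j (suc n))

    n+j/n : (suc n ℕ.+ j) / suc n ≡ suc (j / suc n)
    n+j/n = ≡.trans (m/n≡1+[m∸n]/n (ℕₚ.m≤m+n (suc n) j))
      (≡.cong (λ k → suc (k / suc n)) (ℕₚ.m+n∸m≡n (suc n) j))

    shift : x * geom x n j ≈ geom x n (suc n ℕ.+ j)
    shift rewrite n+j%n | n+j/n with j % suc n ℕ.≟ 0
    ... | yes _ = refl
    ... | no  _ = zeroʳ x

  geom-inverse : ∀ x n → (geom x n *S onePlus (- x) n) ≈S oneS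
  geom-inverse x n = ≈S.begin
    geom x n *S onePlus (- x) n
      ≈S.≈⟨ S.*-congˡ {geom x n} (S.trans (onePlus≈ (- x) n)
              (S.+-congˡ {oneS} (S.*-congʳ {X} (constant-- x)))) ⟩
    geom x n *S (oneS +S ((-S constant x) *S X))
      ≈S.≈⟨ S.*-comm (geom x n) (oneS +S ((-S constant x) *S X)) ⟩
    (oneS +S ((-S constant x) *S X)) *S geom x n
      ≈S.≈⟨ S.distribʳ (geom x n) oneS ((-S constant x) *S X) ⟩
    (oneS *S geom x n) +S (((-S constant x) *S X) *S geom x n)
      ≈S.≈⟨ S.+-cong (S.trans (S.*-identityˡ (geom x n)) (geom-unfold x n))
             (S.trans (S.*-assoc (-S constant x) X (geom x n))
               (S.sym (RP.-‿distribˡ-* (constant x) (X *S geom x n)))) ⟩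
    (oneS +S Y) +S (-S Y)
      ≈S.≈⟨ S.trans (S.+-assoc oneS Y (-S Y)) (S.trans (S.+-congˡ {oneS} (S.-‿inverseʳ Y)) (S.+-identityʳ oneS)) ⟩
    oneS ≈S.∎
    where
    import Algebra.Properties.Ring
    import Relation.Binary.Reasoning.Setoid
    module RP = Algebra.Properties.Ring S.ring
    module ≈S = Relation.Binary.Reasoning.Setoid S.setoid
    X Y : Series
    X = q ^S suc n
    Y = constant x *S (X *S geom x n)

  Vanishes : (ℕ → Set) → Series → Set
  Vanishes Z f = ∀ i → Z i → f i ≈ 0#

  -- Every term of the convolution at an index in Z has a zero factor. The arguments below on gaps,
  -- on triangular indices and on multiples of ℓ are instances with different index sets.
  *S-vanishes : ∀ {Z Z₁ Z₂ : ℕ → Set} {f g} → (∀ i j → Z (i ℕ.+ j) → Z₁ i ⊎ Z₂ j) →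
                Vanishes Z₁ f → Vanishes Z₂ g → Vanishes Z (f *S g)
  *S-vanishes {Z} {f = f} {g} split f-van g-van n Zn = begin
    (f *S g) n                  ≈⟨ *S-diag f g n ⟩
    diag (λ i j → f i * g j) n  ≈⟨ diag≈0 n term ⟩
    0#                          ∎
    where
    open SumsAndProducts R using (diag≈0)
    term : ∀ i j → i ℕ.+ j ≡ n → f i * g j ≈ 0#
    term i j ≡.refl with split i j Zn
    ... | inj₁ Z₁i = trans (*-congʳ (f-van i Z₁i)) (zeroˡ _)
    ... | inj₂ Z₂j = trans (*-congˡ (g-van j Z₂j)) (zeroʳ _)

  vanishes-cong : ∀ {Z : ℕ → Set} {f g} → f ≈S g → Vanishes Z f → Vanishes Z g
  vanishes-cong f≈g f-van i Zi = trans (sym (f≈g i)) (f-van i Zi)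

  q^-vanishes : ∀ k → Vanishes (λ i → ¬ i ≡ k) (q ^S k)
  q^-vanishes k i i≢k = trans (q^-coeff k i) zero-coeff
    where
    zero-coeff : (if ⌊ i ℕ.≟ k ⌋ then 1# else 0#) ≈ 0#
    zero-coeff with i ℕ.≟ k
    ... | yes i≡k = ⊥-elim (i≢k i≡k)
    ... | no  _   = refl

  diag-vanishes : ∀ {Z : ℕ → Set} F n → (∀ k l → k ℕ.+ l ≡ n → Vanishes Z (F k l)) →
                  Vanishes Z (SΠ.diag F n)
  diag-vanishes F zero    van i Zi = van 0 0 ≡.refl i Zi
  diag-vanishes F (suc n) van i Zi = trans
    (+-cong (van 0 (suc n) ≡.refl i Zi)
      (diag-vanishes (λ k l → F (suc k) l) n (λ k l e → van (suc k) l (≡.cong suc e)) i Zi))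
    (+-identityˡ 0#)

-- The quotient by a principal ideal

module Quotient (R : CommutativeRing 0ℓ 0ℓ) (a : CommutativeRing.Carrier R) where

  open CommutativeRing R
  open import Algebra.Properties.Ring ring using (-‿distribʳ-*; -‿+-comm)
  open import Algebra.Solver.Ring.NaturalCoefficients.Default commutativeSemiring
    using (solve; _:+_; _:*_; _:=_)
  open import Relation.Binary.Reasoning.Setoid setoid

  infix 4 _≈/_
  _≈/_ : Carrier → Carrier → Set
  x ≈/ y = ∃ λ h → x ≈ y + a * h

  ≈⇒≈/ : ∀ {x y} → x ≈ y → x ≈/ y
  ≈⇒≈/ x≈y = 0# , trans x≈y (sym (trans (+-congˡ (zeroʳ a)) (+-identityʳ _)))

  ≈/-sym : ∀ {x y} → x ≈/ y → y ≈/ x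
  ≈/-sym {x} {y} (h , x≈y+ah) = - h , sym (begin
    x + a * - h               ≈⟨ +-cong x≈y+ah (sym (-‿distribʳ-* a h)) ⟩
    y + a * h + - (a * h)     ≈⟨ +-assoc _ _ _ ⟩
    y + (a * h + - (a * h))   ≈⟨ +-congˡ (-‿inverseʳ _) ⟩
    y + 0#                    ≈⟨ +-identityʳ y ⟩
    y                         ∎)

  ≈/-trans : ∀ {x y z} → x ≈/ y → y ≈/ z → x ≈/ z
  ≈/-trans (h , x≈y+ah) (k , y≈z+ak) = k + h , trans x≈y+ah (trans (+-congʳ y≈z+ak)
    (solve 4 (λ z a k h → (z :+ a :* k) :+ a :* h := z :+ a :* (k :+ h)) refl _ _ _ _))

  +-cong/ : ∀ {x x′ y y′} → x ≈/ x′ → y ≈/ y′ → x + y ≈/ x′ + y′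
  +-cong/ (h , p) (k , p′) = h + k , trans (+-cong p p′)
    (solve 5 (λ x y a h k → (x :+ a :* h) :+ (y :+ a :* k) := (x :+ y) :+ a :* (h :+ k)) refl _ _ _ _ _)

  *-cong/ : ∀ {x x′ y y′} → x ≈/ x′ → y ≈/ y′ → x * y ≈/ x′ * y′
  *-cong/ {x′ = x′} {y′ = y′} (h , p) (k , p′) = h * y′ + x′ * k + a * (h * k) , trans (*-cong p p′)
    (solve 5 (λ x y a h k → (x :+ a :* h) :* (y :+ a :* k) :=
       x :* y :+ a :* ((h :* y :+ x :* k) :+ a :* (h :* k))) refl _ _ _ _ _)

  neg-cong/ : ∀ {x y} → x ≈/ y → - x ≈/ - y
  neg-cong/ {x} {y} (h , p) = - h , (begin
    - x                  ≈⟨ -‿cong p ⟩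
    - (y + a * h)        ≈⟨ -‿+-comm y (a * h) ⟨
    - y + - (a * h)      ≈⟨ +-congˡ (-‿distribʳ-* a h) ⟩
    - y + a * - h        ∎)

  -- Carrier and operations stay as they are and only the equality is coarsened. So a coefficient
  -- `Ccoef` is an element of the quotient as it stands, and a proof that it vanishes contains the
  -- cofactor of Φ.
  quotientRing : CommutativeRing 0ℓ 0ℓ
  quotientRing = record
    { Carrier = Carrier ; _≈_ = _≈/_ ; _+_ = _+_ ; _*_ = _*_ ; -_ = -_ ; 0# = 0# ; 1# = 1#
    ; isCommutativeRing = record
      { isRing = record
        { +-isAbelianGroup = record
          { isGroup = record
            { isMonoid = record
              { isSemigroup = record
                { isMagma = record
                  { isEquivalence = record
                    { refl = ≈⇒≈/ refl ; sym = ≈/-sym ; trans = ≈/-trans }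
                  ; ∙-cong = +-cong/
                  }
                ; assoc = λ x y z → ≈⇒≈/ (+-assoc x y z)
                }
              ; identity = (λ x → ≈⇒≈/ (+-identityˡ x)) , (λ x → ≈⇒≈/ (+-identityʳ x))
              }
            ; inverse = (λ x → ≈⇒≈/ (-‿inverseˡ x)) , (λ x → ≈⇒≈/ (-‿inverseʳ x))
            ; ⁻¹-cong = neg-cong/
            }
          ; comm = λ x y → ≈⇒≈/ (+-comm x y)
          }
        ; *-cong = *-cong/
        ; *-assoc = λ x y z → ≈⇒≈/ (*-assoc x y z)
        ; *-identity = (λ x → ≈⇒≈/ (*-identityˡ x)) , (λ x → ≈⇒≈/ (*-identityʳ x))
        ; distrib = (λ x y z → ≈⇒≈/ (distribˡ x y z)) , (λ x y z → ≈⇒≈/ (distribʳ x y z))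
        }
      ; *-comm = λ x y → ≈⇒≈/ (*-comm x y)
      }
    }

  a≈/0 : a ≈/ 0#
  a≈/0 = 1# , sym (trans (+-identityˡ _) (*-identityʳ a))

-- Laurent polynomials and the cyclotomic quotient

module LaurentPolynomials where

  open import Data.Integer using (_+_; _*_; -_)
  open ≡ using (refl; sym; trans; cong; cong₂)
  open ≡.≡-Reasoning

  -- The linear functional ζ^e ↦ w e.  Comparing Laurent polynomials through all
  -- functionals subsumes both coefficients and the evaluation at ζ = 1, and makes
  -- multiplication visibly well defined.
  lin : (ℤ → ℤ) → LPoly → ℤ
  lin w []            = + 0
  lin w ((c , e) ∷ f) = c * w e + lin w f

  lin-++ : ∀ w f g → lin w (f ++ g) ≡ lin w f + lin w g
  lin-++ w []            g = sym (ℤₚ.+-identityˡ _)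
  lin-++ w ((c , e) ∷ f) g =
    trans (cong (λ t → c * w e + t) (lin-++ w f g)) (sym (ℤₚ.+-assoc (c * w e) (lin w f) (lin w g)))

  lin-cong : ∀ {w w′} f → (∀ e → w e ≡ w′ e) → lin w f ≡ lin w′ f
  lin-cong []            w≡w′ = refl
  lin-cong ((c , e) ∷ f) w≡w′ = cong₂ _+_ (cong (c *_) (w≡w′ e)) (lin-cong f w≡w′)

  lin-zero : ∀ f → lin (λ _ → + 0) f ≡ + 0
  lin-zero []            = refl
  lin-zero ((c , e) ∷ f) = cong₂ _+_ (ℤₚ.*-zeroʳ c) (lin-zero f)

  lin-combine : ∀ x w w′ f → lin (λ e → x * w e + w′ e) f ≡ x * lin w f + lin w′ f
  lin-combine x w w′ []            = sym (trans (ℤₚ.+-identityʳ _) (ℤₚ.*-zeroʳ x))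
  lin-combine x w w′ ((c , e) ∷ f) = trans (cong (λ t → c * (x * w e + w′ e) + t) (lin-combine x w w′ f))
    (solve 6 (λ c x a b u v → c :* (x :* a :+ b) :+ (x :* u :+ v) := x :* (c :* a :+ u) :+ (c :* b :+ v))
       refl c x (w e) (w′ e) (lin w f) (lin w′ f))
    where open +-*-Solver

  lin-swap : ∀ (w : ℤ → ℤ → ℤ) f g →
             lin (λ e → lin (w e) g) f ≡ lin (λ e′ → lin (λ e → w e e′) f) g
  lin-swap w []            g = sym (lin-zero g)
  lin-swap w ((c , e) ∷ f) g = trans (cong (λ t → c * lin (w e) g + t) (lin-swap w f g))
    (sym (lin-combine c (w e) (λ e′ → lin (λ e → w e e′) f) g))

  lin-monomial-* : ∀ w c e g → lin w (((c , e) ∷ []) *L g) ≡ c * lin (λ e′ → w (e + e′)) g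
  lin-monomial-* w c e []             = sym (ℤₚ.*-zeroʳ c)
  lin-monomial-* w c e ((d , e′) ∷ g) = trans (cong (λ t → c * d * w (e + e′) + t) (lin-monomial-* w c e g))
    (solve 4 (λ c d x y → c :* d :* x :+ c :* y := c :* (d :* x :+ y)) refl c d (w (e + e′)) _)
    where open +-*-Solver

  *L-∷ : ∀ c e f g → ((c , e) ∷ f) *L g ≡ (((c , e) ∷ []) *L g) ++ (f *L g)
  *L-∷ c e f g = Listₚ.concatMap-++ _ ((c , e) ∷ []) f

  lin-* : ∀ w f g → lin w (f *L g) ≡ lin (λ e → lin (λ e′ → w (e + e′)) g) f
  lin-* w []            g = refl
  lin-* w ((c , e) ∷ f) g = begin
    lin w (((c , e) ∷ f) *L g)
      ≡⟨ cong (lin w) (*L-∷ c e f g) ⟩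
    lin w ((((c , e) ∷ []) *L g) ++ (f *L g))
      ≡⟨ lin-++ w (((c , e) ∷ []) *L g) (f *L g) ⟩
    lin w (((c , e) ∷ []) *L g) + lin w (f *L g)
      ≡⟨ cong₂ _+_ (lin-monomial-* w c e g) (lin-* w f g) ⟩
    lin (λ e → lin (λ e′ → w (e + e′)) g) ((c , e) ∷ f) ∎

  infix 4 _≈L_
  _≈L_ : LPoly → LPoly → Set
  f ≈L g = ∀ w → lin w f ≡ lin w g

  -L_ : LPoly → LPoly
  -L f = map (λ (c , e) → (- c , e)) f

  lin-- : ∀ w f → lin w (-L f) ≡ - lin w f
  lin-- w []            = refl
  lin-- w ((c , e) ∷ f) = trans (cong (λ t → - c * w e + t) (lin-- w f))
    (solve 3 (λ c x y → (:- c) :* x :+ (:- y) := :- (c :* x :+ y)) refl c (w e) (lin w f))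
    where open +-*-Solver

  *L-cong : ∀ {f f′ g g′} → f ≈L f′ → g ≈L g′ → f *L g ≈L f′ *L g′
  *L-cong {f} {f′} {g} {g′} f≈f′ g≈g′ w = begin
    lin w (f *L g)                              ≡⟨ lin-* w f g ⟩
    lin (λ e → lin (λ e′ → w (e + e′)) g) f     ≡⟨ lin-cong f (λ e → g≈g′ _) ⟩
    lin (λ e → lin (λ e′ → w (e + e′)) g′) f    ≡⟨ f≈f′ _ ⟩
    lin (λ e → lin (λ e′ → w (e + e′)) g′) f′   ≡⟨ lin-* w f′ g′ ⟨
    lin w (f′ *L g′)                            ∎

  *L-assoc : ∀ f g h → (f *L g) *L h ≈L f *L (g *L h)
  *L-assoc f g h w = begin
    lin w ((f *L g) *L h)
      ≡⟨ lin-* w (f *L g) h ⟩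
    lin (λ e → lin (λ e″ → w (e + e″)) h) (f *L g)
      ≡⟨ lin-* _ f g ⟩
    lin (λ e → lin (λ e′ → lin (λ e″ → w (e + e′ + e″)) h) g) f
      ≡⟨ lin-cong f (λ e → lin-cong g λ e′ → lin-cong h λ e″ → cong w (ℤₚ.+-assoc e e′ e″)) ⟩
    lin (λ e → lin (λ e′ → lin (λ e″ → w (e + (e′ + e″))) h) g) f
      ≡⟨ lin-cong f (λ e → lin-* (λ s → w (e + s)) g h) ⟨
    lin (λ e → lin (λ s → w (e + s)) (g *L h)) f
      ≡⟨ lin-* w f (g *L h) ⟨
    lin w (f *L (g *L h)) ∎

  *L-comm : ∀ f g → f *L g ≈L g *L f
  *L-comm f g w = begin
    lin w (f *L g)                              ≡⟨ lin-* w f g ⟩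
    lin (λ e → lin (λ e′ → w (e + e′)) g) f     ≡⟨ lin-swap (λ e e′ → w (e + e′)) f g ⟩
    lin (λ e′ → lin (λ e → w (e + e′)) f) g     ≡⟨ lin-cong g (λ e′ → lin-cong f λ e → cong w (ℤₚ.+-comm e e′)) ⟩
    lin (λ e′ → lin (λ e → w (e′ + e)) f) g     ≡⟨ lin-* w g f ⟨
    lin w (g *L f)                              ∎

  *L-identityˡ : ∀ f → oneL *L f ≈L f
  *L-identityˡ f w = begin
    lin w (oneL *L f)                      ≡⟨ lin-monomial-* w (+ 1) (+ 0) f ⟩
    + 1 * lin (λ e → w (+ 0 + e)) f        ≡⟨ ℤₚ.*-identityˡ _ ⟩
    lin (λ e → w (+ 0 + e)) f              ≡⟨ lin-cong f (λ e → cong w (ℤₚ.+-identityˡ e)) ⟩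
    lin w f                                ∎

  *L-distribʳ : ∀ h f g → (f +L g) *L h ≈L (f *L h) +L (g *L h)
  *L-distribʳ h f g w = begin
    lin w ((f ++ g) *L h)             ≡⟨ lin-* w (f ++ g) h ⟩
    lin _ (f ++ g)                    ≡⟨ lin-++ _ f g ⟩
    lin _ f + lin _ g                 ≡⟨ cong₂ _+_ (lin-* w f h) (lin-* w g h) ⟨
    lin w (f *L h) + lin w (g *L h)   ≡⟨ lin-++ w (f *L h) (g *L h) ⟨
    lin w ((f *L h) ++ (g *L h))      ∎

  +L-cong : ∀ {f f′ g g′} → f ≈L f′ → g ≈L g′ → f +L g ≈L f′ +L g′
  +L-cong {f} {f′} {g} {g′} f≈f′ g≈g′ w =
    trans (lin-++ w f g) (trans (cong₂ _+_ (f≈f′ w) (g≈g′ w)) (sym (lin-++ w f′ g′)))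

  +L-comm : ∀ f g → f +L g ≈L g +L f
  +L-comm f g w = trans (lin-++ w f g) (trans (ℤₚ.+-comm (lin w f) (lin w g)) (sym (lin-++ w g f)))

  *L-distribˡ : ∀ h f g → h *L (f +L g) ≈L (h *L f) +L (h *L g)
  *L-distribˡ h f g w = trans (*L-comm h (f +L g) w)
    (trans (*L-distribʳ h f g w) (+L-cong {f *L h} {h *L f} {g *L h} {h *L g} (*L-comm f h) (*L-comm g h) w))

  -L-inverseˡ : ∀ f → (-L f) +L f ≈L zeroL
  -L-inverseˡ f w = trans (lin-++ w (-L f) f) (trans (cong (_+ lin w f) (lin-- w f)) (ℤₚ.+-inverseˡ (lin w f)))

  laurentRing : CommutativeRing 0ℓ 0ℓ
  laurentRing = record
    { Carrier = LPoly ; _≈_ = _≈L_ ; _+_ = _+L_ ; _*_ = _*L_ ; -_ = -L_ ; 0# = zeroL ; 1# = oneL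
    ; isCommutativeRing = record
      { isRing = record
        { +-isAbelianGroup = record
          { isGroup = record
            { isMonoid = record
              { isSemigroup = record
                { isMagma = record
                  { isEquivalence = record
                    { refl  = λ _ → refl
                    ; sym   = λ f≈g w → sym (f≈g w)
                    ; trans = λ f≈g g≈h w → trans (f≈g w) (g≈h w)
                    }
                  ; ∙-cong = λ {f} {f′} {g} {g′} → +L-cong {f} {f′} {g} {g′}
                  }
                ; assoc = λ f g h w → cong (lin w) (Listₚ.++-assoc f g h)
                }
              ; identity = (λ f w → refl) , (λ f w → cong (lin w) (Listₚ.++-identityʳ f))
              }
            ; inverse = -L-inverseˡ , λ f w → trans (+L-comm f (-L f) w) (-L-inverseˡ f w)
            ; ⁻¹-cong = λ {f} {g} f≈g w → trans (lin-- w f) (trans (cong -_ (f≈g w)) (sym (lin-- w g)))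
            }
          ; comm = +L-comm
          }
        ; *-cong = λ {f} {f′} {g} {g′} → *L-cong {f} {f′} {g} {g′}
        ; *-assoc = *L-assoc
        ; *-identity = *L-identityˡ , λ f w → trans (*L-comm f oneL w) (*L-identityˡ f w)
        ; distrib = *L-distribˡ , *L-distribʳ
        }
      ; *-comm = *L-comm
      }
    }

  coeffL≡lin : ∀ f j → coeffL f j ≡ lin (λ e → if ⌊ e ℤ.≟ j ⌋ then + 1 else + 0) f
  coeffL≡lin []            j = refl
  coeffL≡lin ((c , e) ∷ f) j = cong₂ _+_ term (coeffL≡lin f j)
    where
    term : (if ⌊ e ℤ.≟ j ⌋ then c else + 0) ≡ c * (if ⌊ e ℤ.≟ j ⌋ then + 1 else + 0)
    term with e ℤ.≟ j
    ... | yes _ = sym (ℤₚ.*-identityʳ c)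
    ... | no  _ = sym (ℤₚ.*-zeroʳ c)

  eval1≡lin : ∀ f → eval1 f ≡ lin (λ _ → + 1) f
  eval1≡lin []            = refl
  eval1≡lin ((c , e) ∷ f) = cong₂ _+_ (sym (ℤₚ.*-identityʳ c)) (eval1≡lin f)

  coeffL-cong : ∀ {f g} → f ≈L g → ∀ j → coeffL f j ≡ coeffL g j
  coeffL-cong {f} {g} f≈g j = trans (coeffL≡lin f j) (trans (f≈g _) (sym (coeffL≡lin g j)))

  eval1-cong : ∀ {f g} → f ≈L g → eval1 f ≡ eval1 g
  eval1-cong {f} {g} f≈g = trans (eval1≡lin f) (trans (f≈g _) (sym (eval1≡lin g)))

  eval1-+ : ∀ f g → eval1 (f +L g) ≡ eval1 f + eval1 g
  eval1-+ []            g = sym (ℤₚ.+-identityˡ _)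
  eval1-+ ((c , e) ∷ f) g = trans (cong (λ x → c + x) (eval1-+ f g)) (sym (ℤₚ.+-assoc c (eval1 f) (eval1 g)))

  eval1-* : ∀ f g → eval1 (f *L g) ≡ eval1 f * eval1 g
  eval1-* f g = begin
    eval1 (f *L g)                               ≡⟨ eval1≡lin (f *L g) ⟩
    lin (λ _ → + 1) (f *L g)                     ≡⟨ lin-* (λ _ → + 1) f g ⟩
    lin (λ _ → lin (λ _ → + 1) g) f              ≡⟨ lin-cong f (λ _ → eval1≡lin g) ⟨
    lin (λ _ → eval1 g) f                        ≡⟨ lin-const (eval1 g) f ⟩
    eval1 f * eval1 g                            ∎
    where
    lin-const : ∀ x f → lin (λ _ → x) f ≡ eval1 f * x
    lin-const x []            = sym (ℤₚ.*-zeroˡ x)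
    lin-const x ((c , e) ∷ f) = trans (cong (λ t → c * x + t) (lin-const x f)) (sym (ℤₚ.*-distribʳ-+ x c (eval1 f)))

  eval1-Φ : ∀ ℓ → eval1 (Φ ℓ) ≡ + ℓ
  eval1-Φ ℓ = go (λ i → i) ℓ
    where
    go : ∀ f n → eval1 (map (λ i → (+ 1 , + i)) (applyUpTo f n)) ≡ + n
    go f zero    = refl
    go f (suc n) = cong (λ x → + 1 + x) (go (λ i → f (suc i)) n)

  open QBinomial laurentRing (zetaL (+ 1)) using ([_])

  -- Links Φ to the q-integer [ℓ], whose vanishing is the hypothesis on the root of unity.
  [n]≈Φ : ∀ n → [ n ] ≈L Φ n
  [n]≈Φ zero    w = refl
  [n]≈Φ (suc n) w = cong (λ x → + 1 * w (+ 0) + x) (begin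
    lin w (zetaL (+ 1) *L [ n ])              ≡⟨ *L-cong {zetaL (+ 1)} {zetaL (+ 1)} {[ n ]} {Φ n} (λ _ → refl) ([n]≈Φ n) w ⟩
    lin w (zetaL (+ 1) *L Φ n)                ≡⟨ lin-monomial-* w (+ 1) (+ 1) (Φ n) ⟩
    + 1 * lin (λ e → w (+ 1 + e)) (Φ n)       ≡⟨ ℤₚ.*-identityˡ _ ⟩
    lin (λ e → w (+ 1 + e)) (Φ n)             ≡⟨ shift (λ i → i) n ⟩
    lin w (map (λ i → (+ 1 , + i)) (applyUpTo suc n)) ∎)
    where
    shift : ∀ f n → lin (λ e → w (+ 1 + e)) (map (λ i → (+ 1 , + i)) (applyUpTo f n)) ≡
                    lin w (map (λ i → (+ 1 , + i)) (applyUpTo (λ i → suc (f i)) n))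
    shift f zero    = refl
    shift f (suc n) = cong (λ t → + 1 * w (+ suc (f 0)) + t) (shift (λ i → f (suc i)) n)

module CyclotomicQuotient (ℓ : ℕ) where

  open LaurentPolynomials
  open Quotient laurentRing (Φ ℓ) public

  module Q = CommutativeRing quotientRing
  open QBinomial quotientRing (zetaL (+ 1)) using ([_])

  [ℓ]≈0 : [ ℓ ] Q.≈ zeroL
  [ℓ]≈0 = ≈/-trans {[ ℓ ]} {Φ ℓ} {zeroL} (≈⇒≈/ {[ ℓ ]} {Φ ℓ} (λ w → ≡.trans (same ℓ w) ([n]≈Φ ℓ w))) a≈/0
    where
    module L = QBinomial laurentRing (zetaL (+ 1))
    -- The two recursions take the same steps but are instances over different rings, so they are
    -- compared by induction.
    same : ∀ n → [ n ] ≈L L.[ n ]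
    same zero    w = ≡.refl
    same (suc n) w = ≡.trans (lin-++ w oneL (zetaL (+ 1) *L [ n ]))
      (≡.trans (≡.cong (λ t → lin w oneL ℤ.+ t) (*L-cong {zetaL (+ 1)} {zetaL (+ 1)} {[ n ]} {L.[ n ]} (λ _ → ≡.refl) (same n) w))
        (≡.sym (lin-++ w oneL (zetaL (+ 1) *L L.[ n ]))))

-- The Jacobi triple product up to q^N

Triangular : ℕ → Set
Triangular n = ∃ λ r → n ≡ tri r

module TripleProduct (R : CommutativeRing 0ℓ 0ℓ) where

  open CommutativeRing R hiding (zero)
  open PowerSeries R
  open SeriesOps 0# 1# _+_ _*_
  open SumsAndProducts seriesRing using (Π; Π-cong; Π-*; Π-head; Π-const; diag; diag-*ˡ)
  open import Algebra.Properties.CommutativeSemiring.Exp S.commutativeSemiring using (_^_)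
  open import Algebra.Properties.Ring ring using (-1*x≈-x)
  open import Algebra.Solver.Ring.NaturalCoefficients.Default S.commutativeSemiring
    using (solve; _:+_; _:*_; _:=_; con)
  open import Relation.Binary.Reasoning.Setoid S.setoid
  module Gauss = QBinomial seriesRing q
  open Gauss using (B)

  prodTo≈Π : ∀ {F G} n → (∀ i → F i ≈S G i) → prodTo F n ≈S Π G n
  prodTo≈Π zero    F≈G i = refl
  prodTo≈Π {F} {G} (suc n) F≈G =
    S.*-cong {prodTo F n} {Π G n} {F n} {G n} (prodTo≈Π n F≈G) (F≈G n)

  onePlus-1≈ : ∀ n → onePlus (- 1#) n ≈S (oneS S.- (q ^ suc n))
  onePlus-1≈ n i = trans (onePlus≈ (- 1#) n i)
    (+-congˡ (trans (constant-*S (- 1#) (q ^ suc n) i) (-1*x≈-x _)))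

  -- Constant coefficients are left free: only the gap after them matters.
  Gap : ℕ → ℕ → Set
  Gap c i = 0 ℕ.< i × i ℕ.≤ c

  gap-*S : ∀ {c} f g → Vanishes (Gap c) f → Vanishes (Gap c) g → Vanishes (Gap c) (f *S g)
  gap-*S {c} f g = *S-vanishes {Gap c} {Gap c} {Gap c} {f} {g} split
    where
    split : ∀ i j → Gap c (i ℕ.+ j) → Gap c i ⊎ Gap c j
    split zero    j gap          = inj₂ gap
    split (suc i) j (_ , i+j≤c)  = inj₁ (ℕ.s≤s ℕ.z≤n , ℕₚ.m+n≤o⇒m≤o (suc i) i+j≤c)

  gap-mono : ∀ {c d} f → c ℕ.≤ d → Vanishes (Gap d) f → Vanishes (Gap c) f
  gap-mono f c≤d f-van i (0<i , i≤c) = f-van i (0<i , ℕₚ.≤-trans i≤c c≤d)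

  gap-oneS : ∀ c → Vanishes (Gap c) oneS
  gap-oneS c (suc i) _ = refl

  gap-onePlus : ∀ x n → Vanishes (Gap n) (onePlus x n)
  gap-onePlus x n (suc i) (_ , i<n) with i ℕ.≟ n
  ... | yes i≡n = ⊥-elim (ℕₚ.<⇒≢ i<n i≡n)
  ... | no  _   = refl

  pochhammer : ℕ → Series
  pochhammer = Π (onePlus (- 1#))

  -- By the step hypothesis, passing from b to b + 1 multiplies the product by 1 - q^(c+b+1), which
  -- has no term in the gap. Only `G 0` has to be known, and nothing is cancelled.
  gap-pochhammer-* : ∀ c (G : ℕ → Series) → Vanishes (Gap c) (G 0) →
    (∀ b → (onePlus (- 1#) b *S G (suc b)) ≈S (onePlus (- 1#) (c ℕ.+ b) *S G b)) →
    ∀ b → Vanishes (Gap c) (pochhammer b *S G b)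
  gap-pochhammer-* c G G0-gap G-step zero    = gap-*S oneS (G 0) (gap-oneS c) G0-gap
  gap-pochhammer-* c G G0-gap G-step (suc b) =
    vanishes-cong {Gap c} {onePlus (- 1#) (c ℕ.+ b) *S (P *S G b)} {(P *S O) *S G (suc b)} eq
      (gap-*S (onePlus (- 1#) (c ℕ.+ b)) (P *S G b)
        (gap-mono (onePlus (- 1#) (c ℕ.+ b)) (ℕₚ.m≤m+n c b) (gap-onePlus (- 1#) (c ℕ.+ b)))
        (gap-pochhammer-* c G G0-gap G-step b))
    where
    P O : Series
    P = pochhammer b
    O = onePlus (- 1#) b
    eq : (onePlus (- 1#) (c ℕ.+ b) *S (P *S G b)) ≈S ((P *S O) *S G (suc b))
    eq = begin
      onePlus (- 1#) (c ℕ.+ b) *S (P *S G b)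
        ≈⟨ solve 3 (λ o p g → o :* (p :* g) := p :* (o :* g)) (λ _ → refl) (onePlus (- 1#) (c ℕ.+ b)) P (G b) ⟩
      P *S (onePlus (- 1#) (c ℕ.+ b) *S G b)
        ≈⟨ S.*-congˡ {P} (G-step b) ⟨
      P *S (O *S G (suc b))
        ≈⟨ S.*-assoc P O (G (suc b)) ⟨
      (P *S O) *S G (suc b) ∎

  -- The further factors are 1 - q^(n+1) with n ≥ b ≥ c, too high to fill the gap.
  gap-pochhammer-extend : ∀ {c b} G → c ℕ.≤ b → Vanishes (Gap c) (pochhammer b *S G) →
    ∀ d → Vanishes (Gap c) (pochhammer (d ℕ.+ b) *S G)
  gap-pochhammer-extend G c≤b van zero    = van
  gap-pochhammer-extend {c} {b} G c≤b van (suc d) =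
    vanishes-cong {Gap c} {O *S (P *S G)} {(P *S O) *S G}
      (solve 3 (λ o p g → o :* (p :* g) := (p :* o) :* g) (λ _ → refl) O P G)
      (gap-*S O (P *S G)
        (gap-mono O (ℕₚ.≤-trans c≤b (ℕₚ.m≤n+m b d)) (gap-onePlus (- 1#) (d ℕ.+ b)))
        (gap-pochhammer-extend G c≤b van d))
    where
    P O : Series
    P = pochhammer (d ℕ.+ b)
    O = onePlus (- 1#) (d ℕ.+ b)

  [1-q^]-step : ∀ m n b c → (Gauss.[ suc m ] *S b) ≈S (Gauss.[ suc n ] *S c) →
                (onePlus (- 1#) m *S b) ≈S (onePlus (- 1#) n *S c)
  [1-q^]-step m n b c eq = begin
    onePlus (- 1#) m *S b          ≈⟨ S.*-congʳ {b} (onePlus-1≈ m) ⟩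
    (oneS S.- (q ^ suc m)) *S b    ≈⟨ Gauss.[1-u^]-from-[] (suc m) (suc n) {b} {c} eq ⟩
    (oneS S.- (q ^ suc n)) *S c    ≈⟨ S.*-congʳ {c} (onePlus-1≈ n) ⟨
    onePlus (- 1#) n *S c          ∎

  -- Informally the product is (1 - q^(k+1))...(1 - q^(k+l)), the Gaussian binomial with one of its
  -- denominators cleared. `gap-B-left` clears the other one.
  gap-B-right : ∀ k l → Vanishes (Gap k) (pochhammer l *S B k l)
  gap-B-right k = gap-pochhammer-* k (B k)
    (vanishes-cong {Gap k} {oneS} {B k 0} (S.sym (Gauss.B-zeroʳ k)) (gap-oneS k))
    (λ b → [1-q^]-step b (k ℕ.+ b) (B k (suc b)) (B k b) (Gauss.[1+l]*B k b))

  gap-B-left : ∀ k l → Vanishes (Gap l) (pochhammer k *S B k l)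
  gap-B-left k l = gap-pochhammer-* l (λ k → B k l) (gap-oneS l)
    (λ b → [1-q^]-step b (l ℕ.+ b) (B (suc b) l) (B b l)
      (S.trans (Gauss.[1+k]*B b l)
        (S.reflexive (≡.cong (λ n → Gauss.[ suc n ] *S B b l) (ℕₚ.+-comm b l)))))
    k

  NonTriangular≤ : ℕ → ℕ → Set
  NonTriangular≤ N i = ¬ Triangular i × i ℕ.≤ N

  -- After q^T itself the next possible term is q^(T+c+1), which lies beyond q^N.
  monomial-gap-vanishes : ∀ N T c f → Triangular T → N ℕ.< T ℕ.+ suc c → Vanishes (Gap c) f →
                          Vanishes (NonTriangular≤ N) ((q ^ T) *S f)
  monomial-gap-vanishes N T c f T-tri N<T+1+c =
    *S-vanishes {NonTriangular≤ N} {λ i → ¬ i ≡ T} {Gap c} {q ^ T} {f} split (q^-vanishes T)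
    where
    split : ∀ i j → NonTriangular≤ N (i ℕ.+ j) → ¬ i ≡ T ⊎ Gap c j
    split i j (nontri , i+j≤N) with i ℕ.≟ T
    ... | no  i≢T    = inj₁ i≢T
    split i zero    (nontri , i+j≤N) | yes ≡.refl =
      ⊥-elim (nontri (≡.subst Triangular (≡.sym (ℕₚ.+-identityʳ i)) T-tri))
    split i (suc j) (nontri , i+j≤N) | yes ≡.refl =
      inj₂ (ℕ.s≤s ℕ.z≤n , ℕ.s≤s⁻¹ (ℕₚ.+-cancelˡ-< i (suc j) (suc c) (ℕₚ.≤-<-trans i+j≤N N<T+1+c)))

  constant-*S-vanishes : ∀ {Z : ℕ → Set} x f → Vanishes Z f → Vanishes Z (constant x *S f)
  constant-*S-vanishes x f f-van i Zi =
    trans (constant-*S x f i) (trans (*-congˡ (f-van i Zi)) (zeroʳ x))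

  constant^-*S-vanishes : ∀ {Z : ℕ → Set} x n f → Vanishes Z f → Vanishes Z ((constant x ^ n) *S f)
  constant^-*S-vanishes {Z} x zero    f f-van = vanishes-cong {Z} {f} {oneS *S f} (S.sym (S.*-identityˡ f)) f-van
  constant^-*S-vanishes {Z} x (suc n) f f-van =
    vanishes-cong {Z} {constant x *S ((constant x ^ n) *S f)} {(constant x ^ suc n) *S f}
      (S.sym (S.*-assoc (constant x) (constant x ^ n) f))
      (constant-*S-vanishes x ((constant x ^ n) *S f) (constant^-*S-vanishes x n f f-van))

  -- This replaces the passage to the limit. The smaller of k and l is at most N, so `pochhammer N`
  -- contains the factors that clear the corresponding denominator of `B k l`. The result has a gap
  -- up to min(k,l), and the estimates on `tri∸` put its end beyond q^N once q^T is multiplied in.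
  summand-vanishes : ∀ z N k l → k ℕ.+ l ≡ suc N ℕ.+ N →
    Vanishes (NonTriangular≤ N)
      (pochhammer N *S ((constant z ^ k) *S ((q ^ tri∸ k (suc N)) *S B k l)))
  summand-vanishes z N k l k+l≡ =
    vanishes-cong {NonTriangular≤ N} {Z *S (Q *S (P *S B k l))} {P *S (Z *S (Q *S B k l))}
      (solve 4 (λ z q p b → z :* (q :* (p :* b)) := p :* (z :* (q :* b))) (λ _ → refl) Z Q P (B k l))
      (constant^-*S-vanishes z k (Q *S (P *S B k l)) core)
    where
    T : ℕ
    T = tri∸ k (suc N)

    P Q Z : Series
    P = pochhammer N
    Q = q ^ T
    Z = constant z ^ k

    T-triangular : Triangular T
    T-triangular = tri∸≡tri k (suc N)

    core : Vanishes (NonTriangular≤ N) (Q *S (P *S B k l))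
    -- As k + l = 2 N + 1, the test decides which of k and l is the smaller.
    core with k ℕ.≤? N
    ... | yes k≤N = monomial-gap-vanishes N T k (P *S B k l) T-triangular (b≤tri∸+1+k k (suc N))
      (≡.subst (λ n → Vanishes (Gap k) (pochhammer n *S B k l)) (ℕₚ.m∸n+n≡m k≤N)
        (gap-pochhammer-extend (B k l) ℕₚ.≤-refl
          (gap-mono (pochhammer k *S B k l) k≤l (gap-B-left k l)) (N ℕ.∸ k)))
      where
      k≤l : k ℕ.≤ l
      k≤l = ℕₚ.≮⇒≥ λ l<k → ℕₚ.<⇒≢
        (ℕ.s≤s (ℕₚ.+-mono-≤ k≤N (ℕₚ.≤-trans (ℕₚ.<⇒≤ l<k) k≤N))) k+l≡
    ... | no  k≰N = monomial-gap-vanishes N T l (P *S B k l) T-triangular (N<tri∸+1+l k l N k+l≡)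
      (≡.subst (λ n → Vanishes (Gap l) (pochhammer n *S B k l)) (ℕₚ.m∸n+n≡m l≤N)
        (gap-pochhammer-extend (B k l) ℕₚ.≤-refl
          (gap-mono (pochhammer l *S B k l) (ℕₚ.≤-trans l≤N (ℕₚ.<⇒≤ (ℕₚ.≰⇒> k≰N))) (gap-B-right k l))
          (N ℕ.∸ l)))
      where
      l≤N : l ℕ.≤ N
      l≤N = ℕₚ.+-cancelˡ-≤ (suc N) l N
        (≡.subst (suc N ℕ.+ l ℕ.≤_) k+l≡ (ℕₚ.+-monoˡ-≤ l (ℕₚ.≰⇒> k≰N)))

  module _ (z z⁻¹ w : Carrier) (z*z⁻¹≈1 : z * z⁻¹ ≈ 1#) (w*[1+z]≈1 : w * (1# + z) ≈ 1#) (N : ℕ) where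

    private
      Z Z⁻¹ W P : Series
      Z   = constant z
      Z⁻¹ = constant z⁻¹
      W   = constant w
      P   = pochhammer N

      below above shifted : ℕ → Series
      below n   = oneS +S (Z⁻¹ *S (q ^ suc n))
      above n   = oneS +S (Z *S (q ^ suc n))
      shifted n = Z +S (q ^ n)

      summand : ℕ → ℕ → Series
      summand k l = (Z ^ k) *S ((q ^ tri∸ k (suc N)) *S B k l)

      Z*Z⁻¹≈1 : (Z *S Z⁻¹) ≈S oneS
      Z*Z⁻¹≈1 = S.trans (S.sym (constant-* z z⁻¹))
        (S.trans (constant-cong z*z⁻¹≈1) (S.sym oneS≈constant))

      W*[1+Z]≈1 : (W *S (oneS +S Z)) ≈S oneS
      W*[1+Z]≈1 = begin
        W *S (oneS +S Z)                ≈⟨ S.*-congˡ {W} (S.+-congʳ {Z} oneS≈constant) ⟩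
        W *S (constant 1# +S constant z) ≈⟨ S.*-congˡ {W} (constant-+ 1# z) ⟨
        W *S constant (1# + z)          ≈⟨ constant-* w (1# + z) ⟨
        constant (w * (1# + z))         ≈⟨ constant-cong w*[1+z]≈1 ⟩
        constant 1#                     ≈⟨ oneS≈constant ⟨
        oneS                            ∎

      shifted-below : ∀ n → below n ≈S (Z⁻¹ *S shifted (suc n))
      shifted-below n = begin
        oneS +S (Z⁻¹ *S (q ^ suc n))        ≈⟨ S.+-congʳ {Z⁻¹ *S (q ^ suc n)} Z*Z⁻¹≈1 ⟨
        (Z *S Z⁻¹) +S (Z⁻¹ *S (q ^ suc n))
          ≈⟨ solve 3 (λ z y x → z :* y :+ y :* x := y :* (z :+ x)) (λ _ → refl) Z Z⁻¹ (q ^ suc n) ⟩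
        Z⁻¹ *S shifted (suc n)              ∎

      -- The finite triple product needs one more factor, z + q^0 = 1 + z. It is supplied by
      -- inserting w (1 + z) = 1, and w stays outside as a constant.
      below-product : Π below N ≈S ((W *S (Z⁻¹ ^ N)) *S Π shifted (suc N))
      below-product = begin
        Π below N
          ≈⟨ Π-cong {below} {λ n → Z⁻¹ *S shifted (suc n)} N (λ n _ → shifted-below n) ⟩
        Π (λ n → Z⁻¹ *S shifted (suc n)) N
          ≈⟨ Π-* (λ _ → Z⁻¹) (λ n → shifted (suc n)) N ⟩
        Π (λ _ → Z⁻¹) N *S Q
          ≈⟨ S.*-congʳ {Q} (Π-const Z⁻¹ N) ⟩
        (Z⁻¹ ^ N) *S Q
          ≈⟨ S.*-identityˡ ((Z⁻¹ ^ N) *S Q) ⟨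
        oneS *S ((Z⁻¹ ^ N) *S Q)
          ≈⟨ S.*-congʳ {(Z⁻¹ ^ N) *S Q} W*[1+Z]≈1 ⟨
        (W *S (oneS +S Z)) *S ((Z⁻¹ ^ N) *S Q)
          ≈⟨ solve 4 (λ w z y x → (w :* (con 1 :+ z)) :* (y :* x) := (w :* y) :* ((z :+ con 1) :* x))
               (λ _ → refl) W Z (Z⁻¹ ^ N) Q ⟩
        (W *S (Z⁻¹ ^ N)) *S (shifted 0 *S Q)
          ≈⟨ S.*-congˡ {W *S (Z⁻¹ ^ N)} (Π-head shifted N) ⟨
        (W *S (Z⁻¹ ^ N)) *S Π shifted (suc N) ∎
        where
        Q : Series
        Q = Π (λ n → shifted (suc n)) N

      as-sum : Π (λ n → (onePlus z n *S onePlus z⁻¹ n) *S onePlus (- 1#) n) N ≈S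
               (W *S ((Z⁻¹ ^ N) *S diag (λ k l → P *S summand k l) (suc N ℕ.+ N)))
      as-sum = begin
        Π (λ n → (onePlus z n *S onePlus z⁻¹ n) *S onePlus (- 1#) n) N
          ≈⟨ Π-* (λ n → onePlus z n *S onePlus z⁻¹ n) (onePlus (- 1#)) N ⟩
        Π (λ n → onePlus z n *S onePlus z⁻¹ n) N *S P
          ≈⟨ S.*-congʳ {P} (Π-* (onePlus z) (onePlus z⁻¹) N) ⟩
        (Π (onePlus z) N *S Π (onePlus z⁻¹) N) *S P
          ≈⟨ S.*-congʳ {P} (S.*-cong {Π (onePlus z) N} {A} {Π (onePlus z⁻¹) N} {(W *S (Z⁻¹ ^ N)) *S C}
               (Π-cong {onePlus z} {above} N (λ n _ → onePlus≈ z n))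
               (S.trans (Π-cong {onePlus z⁻¹} {below} N (λ n _ → onePlus≈ z⁻¹ n)) below-product)) ⟩
        (A *S ((W *S (Z⁻¹ ^ N)) *S C)) *S P
          ≈⟨ solve 5 (λ a w y c p → (a :* ((w :* y) :* c)) :* p := w :* (y :* (p :* (a :* c))))
               (λ _ → refl) A W (Z⁻¹ ^ N) C P ⟩
        W *S ((Z⁻¹ ^ N) *S (P *S (A *S C)))
          ≈⟨ S.*-congˡ {W} (S.*-congˡ {Z⁻¹ ^ N} (S.*-congˡ {P} (Gauss.finite-triple-product Z N (suc N)))) ⟩
        W *S ((Z⁻¹ ^ N) *S (P *S diag summand (suc N ℕ.+ N)))
          ≈⟨ S.*-congˡ {W} (S.*-congˡ {Z⁻¹ ^ N} (diag-*ˡ P summand (suc N ℕ.+ N))) ⟩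
        W *S ((Z⁻¹ ^ N) *S diag (λ k l → P *S summand k l) (suc N ℕ.+ N)) ∎
        where
        A C : Series
        A = Π above N
        C = Π shifted (suc N)

    triple-product-vanishes :
      Vanishes (NonTriangular≤ N) (Π (λ n → (onePlus z n *S onePlus z⁻¹ n) *S onePlus (- 1#) n) N)
    triple-product-vanishes =
      vanishes-cong {NonTriangular≤ N} {W *S ((Z⁻¹ ^ N) *S D)} (S.sym as-sum)
        (constant-*S-vanishes w ((Z⁻¹ ^ N) *S D)
          (constant^-*S-vanishes z⁻¹ N D
            (diag-vanishes (λ k l → P *S summand k l) (suc N ℕ.+ N) (summand-vanishes z N))))
      where
      D : Series
      D = diag (λ k l → P *S summand k l) (suc N ℕ.+ N)

-- Powers and products of series as they occur in the crank

odd/2 : ∀ h → suc (h ℕ.+ h) / 2 ≡ h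
odd/2 h = ≡.trans (≡.cong (λ k → suc k / 2) h+h≡h*2)
  (≡.trans (+-distrib-/-∣ʳ 1 {h ℕ.* 2} {2} (ℕ∣.divides h ≡.refl)) (m*n/n≡m h 2))
  where
  h+h≡h*2 : h ℕ.+ h ≡ h ℕ.* 2
  h+h≡h*2 = ≡.trans (≡.cong (h ℕ.+_) (≡.sym (ℕₚ.+-identityʳ h))) (ℕₚ.*-comm 2 h)

module SeriesProducts (R : CommutativeRing 0ℓ 0ℓ) where

  open CommutativeRing R hiding (zero)
  open PowerSeries R
  open SeriesOps 0# 1# _+_ _*_
  open SumsAndProducts seriesRing using (Π; Π-head)
  open import Algebra.Properties.CommutativeSemiring.Exp S.commutativeSemiring
    using (_^_; ^-homo-*; ^-assocʳ; ^-distrib-*; ^-congˡ)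
  open import Algebra.Solver.Ring.NaturalCoefficients.Default S.commutativeSemiring
    using (solve; _:*_; _:=_; con)
  open import Relation.Binary.Reasoning.Setoid S.setoid

  powS≡^ : ∀ f n → powS f n ≡ f ^ n
  powS≡^ f zero    = ≡.refl
  powS≡^ f (suc n) = ≡.cong (f *S_) (powS≡^ f n)

  prodList≈Π : ∀ (F : ℕ → Series) (o f : ℕ → ℕ) n →
               prodList (map F (map o (applyUpTo f n))) ≈S Π (λ i → F (o (f i))) n
  prodList≈Π F o f zero    = S.refl {oneS}
  prodList≈Π F o f (suc n) = S.trans
    (S.*-congˡ {F (o (f 0))} (prodList≈Π F o (λ i → f (suc i)) n))
    (S.sym (Π-head (λ i → F (o (f i))) n))

  prodList-const : ∀ f (as : List ℕ) → prodList (map (λ _ → f) as) ≡ f ^ length as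
  prodList-const f []       = ≡.refl
  prodList-const f (_ ∷ as) = ≡.cong (f *S_) (prodList-const f as)

  -- At ζ = 1 all geometric factors become one series g, so only their number matters; the list
  -- enters through its length.
  crank-factor-at-one : ∀ f g (as : List ℕ) m →
    (f *S (f *S (powS g m *S powS (prodList (map (λ _ → g *S g) as)) (suc m)))) ≈S
    (powS f 2 *S powS g (m ℕ.+ (length as ℕ.+ length as) ℕ.* suc m))
  crank-factor-at-one f g as m
    rewrite powS≡^ g m | powS≡^ g (m ℕ.+ (length as ℕ.+ length as) ℕ.* suc m)
          | prodList-const (g *S g) as | powS≡^ ((g *S g) ^ length as) m = begin
    f *S (f *S ((g ^ m) *S (((g *S g) ^ h) ^ suc m)))
      ≈⟨ S.*-congˡ {f} (S.*-congˡ {f} (S.*-congˡ {g ^ m}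
           (S.trans (^-congˡ (suc m) {(g *S g) ^ h} {g ^ (h ℕ.+ h)}
             (S.trans (^-distrib-* g g h) (S.sym (^-homo-* g h h))))
             (^-assocʳ g (h ℕ.+ h) (suc m))))) ⟩
    f *S (f *S ((g ^ m) *S (g ^ ((h ℕ.+ h) ℕ.* suc m))))
      ≈⟨ S.*-congˡ {f} (S.*-congˡ {f} (^-homo-* g m ((h ℕ.+ h) ℕ.* suc m))) ⟨
    f *S (f *S (g ^ (m ℕ.+ (h ℕ.+ h) ℕ.* suc m)))
      ≈⟨ solve 2 (λ f x → f :* (f :* x) := (f :* (f :* con 1)) :* x) (λ _ → refl) f
           (g ^ (m ℕ.+ (h ℕ.+ h) ℕ.* suc m)) ⟩
    (f *S (f *S oneS)) *S (g ^ (m ℕ.+ (h ℕ.+ h) ℕ.* suc m)) ∎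
    where
    h : ℕ
    h = length as

-- The crank series at a root of unity

module Crank
  (R : CommutativeRing 0ℓ 0ℓ)
  (e : ℤ → CommutativeRing.Carrier R)
  (e-+ : ∀ i j → CommutativeRing._≈_ R (e (i ℤ.+ j)) (CommutativeRing._*_ R (e i) (e j)))
  (e-0 : CommutativeRing._≈_ R (e (+ 0)) (CommutativeRing.1# R))
  (h : ℕ) (ℓ-prime : Prime (suc (h ℕ.+ h)))
  ([ℓ]≈0 : CommutativeRing._≈_ R (QBinomial.[_] R (e (+ 1)) (suc (h ℕ.+ h))) (CommutativeRing.0# R))
  where

  open CommutativeRing R hiding (zero)
  open PowerSeries R
  open SeriesOps 0# 1# _+_ _*_
  open SeriesProducts R
  open TripleProduct R using (prodTo≈Π; NonTriangular≤; triple-product-vanishes)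
  open SumsAndProducts seriesRing using (Π; Π-cong; Π-*; Π-one)
  open import Algebra.Properties.CommutativeSemiring.Exp S.commutativeSemiring
    using (_^_; ^-assocʳ; ^-distrib-*; ^-congʳ)
  open import Algebra.Properties.Semiring.Exp semiring using () renaming (_^_ to _^R_)
  open import Algebra.Properties.Ring ring using (-1*x≈-x; -‿involutive)
  open import Algebra.Solver.Ring.NaturalCoefficients.Default S.commutativeSemiring
    using (solve; _:+_; _:*_; _:=_; con)
  open import Relation.Binary.Reasoning.Setoid S.setoid

  private
    ℓ : ℕ
    ℓ = suc (h ℕ.+ h)

    ζ : Series
    ζ = constant (e (+ 1))

    odd : ℕ → ℕ
    odd i = 1 ℕ.+ 2 ℕ.* i

    geomPair onePlusPair : ℕ → ℕ → Series
    geomPair n a    = geom (e (+ a)) n *S geom (e (ℤ.- (+ a))) n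
    onePlusPair n a = onePlus (- e (+ a)) n *S onePlus (- e (ℤ.- (+ a))) n

    -- `K n` is one copy of the completed reciprocal denominator and `D n` the polynomial inverse to
    -- it, to which the product over roots of unity applies.
    geomOdds K D : ℕ → Series
    geomOdds n = prodList (map (geomPair n) (oddsBelow ℓ))
    K n        = geom 1# n *S geomOdds n
    D n        = onePlus (- 1#) n *S Π (λ i → onePlusPair n (odd i)) h

    module R-roots = OddPrimeRootOfUnity R (e (+ 1)) h ℓ-prime [ℓ]≈0
    module R-Gauss = QBinomial R (e (+ 1))
    module S-Gauss = QBinomial seriesRing ζ

    [n]-constant : ∀ n → S-Gauss.[ n ] ≈S constant R-Gauss.[ n ]
    [n]-constant zero    zero    = refl
    [n]-constant zero    (suc _) = refl
    [n]-constant (suc n) = begin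
      oneS +S (ζ *S S-Gauss.[ n ])
        ≈⟨ S.+-cong oneS≈constant (S.*-congˡ {ζ} ([n]-constant n)) ⟩
      constant 1# +S (ζ *S constant R-Gauss.[ n ])
        ≈⟨ S.+-congˡ {constant 1#} (constant-* (e (+ 1)) R-Gauss.[ n ]) ⟨
      constant 1# +S constant (e (+ 1) * R-Gauss.[ n ])
        ≈⟨ constant-+ 1# (e (+ 1) * R-Gauss.[ n ]) ⟨
      constant R-Gauss.[ suc n ] ∎

    [ℓ]S≈0 : S-Gauss.[ ℓ ] ≈S zeroS
    [ℓ]S≈0 zero    = trans ([n]-constant ℓ 0) [ℓ]≈0
    [ℓ]S≈0 (suc i) = [n]-constant ℓ (suc i)

    -- The product formula is needed at the series x = - q^(n+1), so ζ is moved into the series ring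
    -- as a constant.
    module S-roots = OddPrimeRootOfUnity seriesRing ζ h ℓ-prime [ℓ]S≈0

    e-^ : ∀ a → e (+ 1) ^R a ≈ e (+ a)
    e-^ zero    = sym e-0
    e-^ (suc a) = trans (*-congˡ (e-^ a)) (sym (e-+ (+ 1) (+ a)))

    ζ^ : ∀ a → (ζ ^ a) ≈S constant (e (+ a))
    ζ^ a = S.trans (S.sym (constant-^ (e (+ 1)) a)) (constant-cong (e-^ a))

    ε : ℕ → Series
    ε a = constant (e (ℤ.- (+ a)))

    ε-inverse : ∀ a → (ε a *S (ζ ^ a)) ≈S oneS
    ε-inverse a = begin
      ε a *S (ζ ^ a)                            ≈⟨ S.*-congˡ {ε a} (ζ^ a) ⟩
      ε a *S constant (e (+ a))                 ≈⟨ constant-* (e (ℤ.- (+ a))) (e (+ a)) ⟨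
      constant (e (ℤ.- (+ a)) * e (+ a))        ≈⟨ constant-cong (trans (sym (e-+ (ℤ.- (+ a)) (+ a)))
                                                     (trans (reflexive (≡.cong e (ℤₚ.+-inverseˡ (+ a)))) e-0)) ⟩
      constant 1#                               ≈⟨ oneS≈constant ⟨
      oneS                                      ∎

    minus : Series
    minus = constant (- 1#)

    minus*minus : (minus *S minus) ≈S oneS
    minus*minus = S.trans (S.sym (constant-* (- 1#) (- 1#)))
      (S.trans (constant-cong (trans (-1*x≈-x (- 1#)) (-‿involutive 1#))) (S.sym oneS≈constant))

    minus^odd : ∀ k → (minus ^ suc (k ℕ.+ k)) ≈S minus
    minus^odd zero    = S.*-identityʳ minus
    minus^odd (suc k) rewrite ℕₚ.+-suc k k = begin
      minus *S (minus *S (minus ^ suc (k ℕ.+ k)))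
        ≈⟨ S.*-assoc minus minus (minus ^ suc (k ℕ.+ k)) ⟨
      (minus *S minus) *S (minus ^ suc (k ℕ.+ k))
        ≈⟨ S.*-cong {minus *S minus} {oneS} {minus ^ suc (k ℕ.+ k)} {minus} minus*minus (minus^odd k) ⟩
      oneS *S minus
        ≈⟨ S.*-identityˡ minus ⟩
      minus ∎

    onePlus-neg : ∀ n y Y → Y ≈S constant y →
                  onePlus (- y) n ≈S (oneS +S ((minus *S (q ^ suc n)) *S Y))
    onePlus-neg n y Y Y≈y = begin
      onePlus (- y) n
        ≈⟨ onePlus≈ (- y) n ⟩
      oneS +S (constant (- y) *S X)
        ≈⟨ S.+-congˡ {oneS} (S.*-congʳ {X} (S.trans (constant-cong (sym (-1*x≈-x y))) (constant-* (- 1#) y))) ⟩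
      oneS +S ((minus *S constant y) *S X)
        ≈⟨ S.+-congˡ {oneS} (S.*-congʳ {X} (S.*-congˡ {minus} Y≈y)) ⟨
      oneS +S ((minus *S Y) *S X)
        ≈⟨ solve 3 (λ s y x → con 1 :+ (s :* y) :* x := con 1 :+ (s :* x) :* y) (λ _ → refl) minus Y X ⟩
      oneS +S ((minus *S X) *S Y) ∎
      where
      X : Series
      X = q ^ suc n

    -- Chosen so that `suc (scale n)` computes to ℓ (n + 1); `onePlus` and `geom` take the exponent
    -- less one.
    scale : ℕ → ℕ
    scale n = n ℕ.+ (h ℕ.+ h) ℕ.* suc n

    -- This is `symmetric-roots-product` at x = - q^(n+1); as ℓ is odd, the sign survives in x^ℓ.
    D≈onePlus : ∀ n → D n ≈S onePlus (- 1#) (scale n)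
    D≈onePlus n = begin
      onePlus (- 1#) n *S Π (λ i → onePlusPair n (odd i)) h
        ≈⟨ S.*-cong {onePlus (- 1#) n} {oneS +S x} {Π (λ i → onePlusPair n (odd i)) h} {Π roots h}
             (onePlus≈ (- 1#) n) (Π-cong {λ i → onePlusPair n (odd i)} {roots} h λ i _ → pair i) ⟩
      (oneS +S x) *S Π roots h
        ≈⟨ S-roots.symmetric-roots-product ε ε-inverse x ⟩
      oneS +S (x ^ ℓ)
        ≈⟨ S.+-congˡ {oneS} (^-distrib-* minus X ℓ) ⟩
      oneS +S ((minus ^ ℓ) *S (X ^ ℓ))
        ≈⟨ S.+-congˡ {oneS} (S.*-cong {minus ^ ℓ} {minus} {X ^ ℓ} {q ^ suc (scale n)} (minus^odd h)
             (S.trans (^-assocʳ q (suc n) ℓ) (^-congʳ q (ℕₚ.*-comm (suc n) ℓ)))) ⟩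
      oneS +S (minus *S (q ^ suc (scale n)))
        ≈⟨ onePlus≈ (- 1#) (scale n) ⟨
      onePlus (- 1#) (scale n) ∎
      where
      X x : Series
      X = q ^ suc n
      x = minus *S X

      roots : ℕ → Series
      roots i = (oneS +S (x *S (ζ ^ suc (i ℕ.+ i)))) *S (oneS +S (x *S ε (suc (i ℕ.+ i))))

      odd≡ : ∀ i → odd i ≡ suc (i ℕ.+ i)
      odd≡ i = ≡.cong (λ k → suc (i ℕ.+ k)) (ℕₚ.+-identityʳ i)

      pair : ∀ i → onePlusPair n (odd i) ≈S roots i
      pair i = S.trans (S.reflexive (≡.cong (onePlusPair n) (odd≡ i)))
        (S.*-cong {onePlus (- e (+ a)) n} {oneS +S (x *S (ζ ^ a))}
                 {onePlus (- e (ℤ.- (+ a))) n} {oneS +S (x *S ε a)}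
          (onePlus-neg n (e (+ a)) (ζ ^ a) (ζ^ a))
          (onePlus-neg n (e (ℤ.- (+ a))) (ε a) (S.refl {ε a})))
        where
        a : ℕ
        a = suc (i ℕ.+ i)

    geomOdds≈Π : ∀ n → geomOdds n ≈S Π (λ i → geomPair n (odd i)) h
    geomOdds≈Π n rewrite odd/2 h = prodList≈Π (geomPair n) odd (λ i → i) h

    K*D≈1 : ∀ n → (K n *S D n) ≈S oneS
    K*D≈1 n = begin
      (geom 1# n *S geomOdds n) *S (onePlus (- 1#) n *S Πo)
        ≈⟨ solve 4 (λ a b c d → (a :* b) :* (c :* d) := (a :* c) :* (b :* d)) (λ _ → refl)
             (geom 1# n) (geomOdds n) (onePlus (- 1#) n) Πo ⟩
      (geom 1# n *S onePlus (- 1#) n) *S (geomOdds n *S Πo)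
        ≈⟨ S.*-cong {geom 1# n *S onePlus (- 1#) n} {oneS} {geomOdds n *S Πo} {oneS}
             (geom-inverse 1# n) odds ⟩
      oneS *S oneS
        ≈⟨ S.*-identityˡ oneS ⟩
      oneS ∎
      where
      Πo : Series
      Πo = Π (λ i → onePlusPair n (odd i)) h

      pair : ∀ a → (geomPair n a *S onePlusPair n a) ≈S oneS
      pair a = begin
        (g₁ *S g₂) *S (o₁ *S o₂)
          ≈⟨ solve 4 (λ a b c d → (a :* b) :* (c :* d) := (a :* c) :* (b :* d)) (λ _ → refl) g₁ g₂ o₁ o₂ ⟩
        (g₁ *S o₁) *S (g₂ *S o₂)
          ≈⟨ S.*-cong {g₁ *S o₁} {oneS} {g₂ *S o₂} {oneS}
               (geom-inverse (e (+ a)) n) (geom-inverse (e (ℤ.- (+ a))) n) ⟩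
        oneS *S oneS
          ≈⟨ S.*-identityˡ oneS ⟩
        oneS ∎
        where
        g₁ g₂ o₁ o₂ : Series
        g₁ = geom (e (+ a)) n
        g₂ = geom (e (ℤ.- (+ a))) n
        o₁ = onePlus (- e (+ a)) n
        o₂ = onePlus (- e (ℤ.- (+ a))) n

      odds : (geomOdds n *S Πo) ≈S oneS
      odds = begin
        geomOdds n *S Πo
          ≈⟨ S.*-congʳ {Πo} (geomOdds≈Π n) ⟩
        Π (λ i → geomPair n (odd i)) h *S Πo
          ≈⟨ Π-* (λ i → geomPair n (odd i)) (λ i → onePlusPair n (odd i)) h ⟨
        Π (λ i → geomPair n (odd i) *S onePlusPair n (odd i)) h
          ≈⟨ Π-cong {λ i → geomPair n (odd i) *S onePlusPair n (odd i)} {λ _ → oneS} h (λ i _ → pair (odd i)) ⟩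
        Π (λ _ → oneS) h
          ≈⟨ Π-one h ⟩
        oneS ∎

    -- Uniqueness of inverses: both sides are inverse to 1 - q^(ℓ(n+1)).
    K≈geom : ∀ n → K n ≈S geom 1# (scale n)
    K≈geom n = begin
      K n                 ≈⟨ S.*-identityʳ (K n) ⟨
      K n *S oneS         ≈⟨ S.*-congˡ {K n} (geom-inverse 1# (scale n)) ⟨
      K n *S (g *S o)     ≈⟨ solve 3 (λ k g o → k :* (g :* o) := g :* (k :* o)) (λ _ → refl) (K n) g o ⟩
      g *S (K n *S o)     ≈⟨ S.*-congˡ {g} (S.*-congˡ {K n} (D≈onePlus n)) ⟨
      g *S (K n *S D n)   ≈⟨ S.*-congˡ {g} (K*D≈1 n) ⟩
      g *S oneS           ≈⟨ S.*-identityʳ g ⟩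
      g                   ∎
      where
      g o : Series
      g = geom 1# (scale n)
      o = onePlus (- 1#) (scale n)

    NonMultiple : ℕ → Set
    NonMultiple i = ¬ ℓ ∣ i

    *S-nonMultiple : ∀ f g → Vanishes NonMultiple f → Vanishes NonMultiple g →
                     Vanishes NonMultiple (f *S g)
    *S-nonMultiple f g = *S-vanishes {NonMultiple} {NonMultiple} {NonMultiple} {f} {g} split
      where
      split : ∀ i j → NonMultiple (i ℕ.+ j) → NonMultiple i ⊎ NonMultiple j
      split i j ℓ∤i+j with ℓ ℕ∣.∣? i
      ... | no  ℓ∤i = inj₁ ℓ∤i
      ... | yes ℓ∣i = inj₂ λ ℓ∣j → ℓ∤i+j (ℕ∣.∣m∣n⇒∣m+n ℓ∣i ℓ∣j)

    oneS-nonMultiple : Vanishes NonMultiple oneS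
    oneS-nonMultiple zero    ℓ∤0 = ⊥-elim (ℓ∤0 (ℓ ℕ∣.∣0))
    oneS-nonMultiple (suc _) _   = refl

    ^-nonMultiple : ∀ f n → Vanishes NonMultiple f → Vanishes NonMultiple (f ^ n)
    ^-nonMultiple f zero    f-van = oneS-nonMultiple
    ^-nonMultiple f (suc n) f-van = *S-nonMultiple f (f ^ n) f-van (^-nonMultiple f n f-van)

    Π-nonMultiple : ∀ F n → (∀ i → Vanishes NonMultiple (F i)) → Vanishes NonMultiple (Π F n)
    Π-nonMultiple F zero    F-van = oneS-nonMultiple
    Π-nonMultiple F (suc n) F-van = *S-nonMultiple (Π F n) (F n) (Π-nonMultiple F n F-van) (F-van n)

    geom-nonMultiple : ∀ x n → Vanishes NonMultiple (geom x (scale n))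
    geom-nonMultiple x n i ℓ∤i with i % suc (scale n) ℕ.≟ 0
    ... | no  _   = refl
    ... | yes i%≡0 = ⊥-elim (ℓ∤i (ℕ∣.∣-trans (ℕ∣.m∣m*n {ℓ} (suc n)) (ℕ∣.m%n≡0⇒n∣m i (suc (scale n)) i%≡0)))

    J : ℕ → Series
    J n = (onePlus (e (+ 2)) n *S onePlus (e (ℤ.- (+ 2))) n) *S onePlus (- 1#) n

  module _ (m : ℕ) where

    crankFactor : ℕ → Series
    crankFactor n =
      onePlus (e (+ 2)) n *S
      (onePlus (e (ℤ.- (+ 2))) n *S
      (powS (geom 1# n) m *S powS (geomOdds n) (suc m)))

    -- Inserting 1 = `geom 1# n` · (1 - q^(n+1)) gives the numerator its third triple product factor
    -- and lifts the exponent m to m + 1, the exponent of the odd part.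
    crankFactor≈ : ∀ n → crankFactor n ≈S (J n *S (K n ^ suc m))
    crankFactor≈ n rewrite powS≡^ (geom 1# n) m | powS≡^ (geomOdds n) m = begin
      a *S (b *S ((g ^ m) *S (r *S (r ^ m))))
        ≈⟨ S.*-identityˡ (a *S (b *S ((g ^ m) *S (r *S (r ^ m))))) ⟨
      oneS *S (a *S (b *S ((g ^ m) *S (r *S (r ^ m)))))
        ≈⟨ S.*-congʳ {a *S (b *S ((g ^ m) *S (r *S (r ^ m))))} (geom-inverse 1# n) ⟨
      (g *S o) *S (a *S (b *S ((g ^ m) *S (r *S (r ^ m)))))
        ≈⟨ solve 7 (λ g o a b x r y → (g :* o) :* (a :* (b :* (x :* (r :* y)))) :=
             ((a :* b) :* o) :* ((g :* r) :* (x :* y))) (λ _ → refl) g o a b (g ^ m) r (r ^ m) ⟩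
      J n *S ((g *S r) *S ((g ^ m) *S (r ^ m)))
        ≈⟨ S.*-congˡ {J n} (S.*-congˡ {g *S r} (^-distrib-* g r m)) ⟨
      J n *S (K n ^ suc m) ∎
      where
      a b g r o : Series
      a = onePlus (e (+ 2)) n
      b = onePlus (e (ℤ.- (+ 2))) n
      g = geom 1# n
      r = geomOdds n
      o = onePlus (- 1#) n

    -- A nonzero term at q^N would split N into a triangular index from the triple product and a
    -- multiple of ℓ from the powers of `K`; the hypothesis rules this out.
    crank-vanishes : ∀ N → (∀ i j → i ℕ.+ j ≡ N → ℓ ∣ j → ¬ Triangular i) →
                     prodTo crankFactor N N ≈ 0#
    crank-vanishes N nontri =
      vanishes-cong {_≡ N} {Π J N *S Π (λ n → K n ^ suc m) N} {prodTo crankFactor N}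
        (S.sym (S.trans (prodTo≈Π N crankFactor≈) (Π-* J (λ n → K n ^ suc m) N)))
        (*S-vanishes {_≡ N} {NonTriangular≤ N} {NonMultiple} {Π J N} {Π (λ n → K n ^ suc m) N} split
          (triple-product-vanishes (e (+ 2)) (e (ℤ.- (+ 2))) (proj₁ R-roots.1+ζ²-unit) z*z⁻¹≈1 w*[1+z]≈1 N)
          (Π-nonMultiple (λ n → K n ^ suc m) N λ n → ^-nonMultiple (K n) (suc m)
            (vanishes-cong {NonMultiple} {geom 1# (scale n)} {K n} (S.sym (K≈geom n)) (geom-nonMultiple 1# n))))
        N ≡.refl
      where
      z*z⁻¹≈1 : e (+ 2) * e (ℤ.- (+ 2)) ≈ 1#
      z*z⁻¹≈1 = trans (sym (e-+ (+ 2) (ℤ.- (+ 2)))) e-0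

      w*[1+z]≈1 : proj₁ R-roots.1+ζ²-unit * (1# + e (+ 2)) ≈ 1#
      w*[1+z]≈1 = trans (*-comm _ _) (trans (*-congʳ (+-congˡ (e-+ (+ 1) (+ 1)))) (proj₂ R-roots.1+ζ²-unit))

      split : ∀ i j → i ℕ.+ j ≡ N → NonTriangular≤ N i ⊎ NonMultiple j
      split i j i+j≡N with ℓ ℕ∣.∣? j
      ... | no  ℓ∤j = inj₂ ℓ∤j
      ... | yes ℓ∣j = inj₁ (nontri i j i+j≡N ℓ∣j , ≡.subst (i ℕ.≤_) i+j≡N (ℕₚ.m≤m+n i j))

-- Transfer between coefficient structures and specialisation at ζ = 1

module SeriesRelation
  {A B : Set}
  (0A 1A : A) (_+A_ _*A_ : A → A → A)
  (0B 1B : B) (_+B_ _*B_ : B → B → B)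
  (_~_ : A → B → Set)
  (0~ : 0A ~ 0B) (1~ : 1A ~ 1B)
  (+~ : ∀ {a b a′ b′} → a ~ b → a′ ~ b′ → (a +A a′) ~ (b +B b′))
  (*~ : ∀ {a b a′ b′} → a ~ b → a′ ~ b′ → (a *A a′) ~ (b *B b′))
  where

  private
    module SA = SeriesOps 0A 1A _+A_ _*A_
    module SB = SeriesOps 0B 1B _+B_ _*B_

  infix 4 _≈~_
  _≈~_ : SA.Series → SB.Series → Set
  f ≈~ g = ∀ i → f i ~ g i

  sumTo~ : ∀ {f g} → f ≈~ g → ∀ n → SA.sumTo f n ~ SB.sumTo g n
  sumTo~ f~g zero    = f~g 0
  sumTo~ f~g (suc n) = +~ (sumTo~ f~g n) (f~g (suc n))

  oneS~ : SA.oneS ≈~ SB.oneS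
  oneS~ zero    = 1~
  oneS~ (suc _) = 0~

  *S~ : ∀ f g f′ g′ → f ≈~ g → f′ ≈~ g′ → (f SA.*S f′) ≈~ (g SB.*S g′)
  *S~ f g f′ g′ f~g f′~g′ n = sumTo~ (λ i → *~ (f~g i) (f′~g′ (n ℕ.∸ i))) n

  powS~ : ∀ {f g} n → f ≈~ g → SA.powS f n ≈~ SB.powS g n
  powS~ zero    f~g = oneS~
  powS~ {f} {g} (suc n) f~g = *S~ f g (SA.powS f n) (SB.powS g n) f~g (powS~ n f~g)

  powA~ : ∀ {x y} n → x ~ y → SA.powA x n ~ SB.powA y n
  powA~ zero    x~y = 1~
  powA~ (suc n) x~y = *~ x~y (powA~ n x~y)

  onePlus~ : ∀ {x y} n → x ~ y → SA.onePlus x n ≈~ SB.onePlus y n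
  onePlus~ n x~y zero = 1~
  onePlus~ n x~y (suc i) with i ℕ.≟ n
  ... | yes _ = x~y
  ... | no  _ = 0~

  geom~ : ∀ {x y} n → x ~ y → SA.geom x n ≈~ SB.geom y n
  geom~ n x~y i with i % suc n ℕ.≟ 0
  ... | yes _ = powA~ (i / suc n) x~y
  ... | no  _ = 0~

  prodTo~ : ∀ {F G} n → (∀ i → F i ≈~ G i) → SA.prodTo F n ≈~ SB.prodTo G n
  prodTo~ zero    F~G = oneS~
  prodTo~ {F} {G} (suc n) F~G =
    *S~ (SA.prodTo F n) (SB.prodTo G n) (F n) (G n) (prodTo~ n F~G) (F~G n)

  prodList~ : ∀ {F : ℕ → SA.Series} {G : ℕ → SB.Series} as → (∀ a → F a ≈~ G a) →
              SA.prodList (map F as) ≈~ SB.prodList (map G as)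
  prodList~ []       F~G = oneS~
  prodList~ {F} {G} (a ∷ as) F~G =
    *S~ (F a) (G a) (SA.prodList (map F as)) (SB.prodList (map G as)) (F~G a) (prodList~ as F~G)

module AtOne where

  open LaurentPolynomials using (eval1-+; eval1-*)
  open PowerSeries ℤₚ.+-*-commutativeRing using (module S)
  open SeriesOps (+ 0) (+ 1) ℤ._+_ ℤ._*_
  open SeriesProducts ℤₚ.+-*-commutativeRing using (crank-factor-at-one)
  open TripleProduct ℤₚ.+-*-commutativeRing using (prodTo≈Π)

  -- The two sides of the specialisation meet in ℤ, where ring identities apply: `Eval` comes down
  -- from Laurent polynomials and `Embed` up from ℕ. The series constructions are parametric in the
  -- coefficients, so only 0, 1, sums and products have to be respected.
  module Eval = SeriesRelation
    zeroL oneL _+L_ _*L_ (+ 0) (+ 1) ℤ._+_ ℤ._*_ (λ f x → eval1 f ≡ x) ≡.refl ≡.refl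
    (λ {f} {_} {g} p p′ → ≡.trans (eval1-+ f g) (≡.cong₂ ℤ._+_ p p′))
    (λ {f} {_} {g} p p′ → ≡.trans (eval1-* f g) (≡.cong₂ ℤ._*_ p p′))

  module Embed = SeriesRelation
    0 1 ℕ._+_ ℕ._*_ (+ 0) (+ 1) ℤ._+_ ℤ._*_ (λ n x → + n ≡ x) ≡.refl ≡.refl
    (λ p p′ → ≡.cong₂ ℤ._+_ p p′)
    (λ {m} {_} {n} p p′ → ≡.trans (ℤₚ.pos-* m n) (≡.cong₂ ℤ._*_ p p′))

  crankFactorℤ : ℕ → ℕ → ℕ → Series
  crankFactorℤ ℓ m n =
    onePlus (+ 1) n *S (onePlus (+ 1) n *S
    (powS (geom (+ 1) n) m *S
     powS (prodList (map (λ _ → geom (+ 1) n *S geom (+ 1) n) (oddsBelow ℓ))) (suc m)))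

  eval-crankFactor : ∀ ℓ m n → CFactor ℓ m n Eval.≈~ crankFactorℤ ℓ m n
  eval-crankFactor ℓ m n =
    Eval.*S~ F₂ f (F₋₂ LS.*S (Gs LS.*S Ps)) (f *S (gs *S ps)) (Eval.onePlus~ n ≡.refl)
      (Eval.*S~ F₋₂ f (Gs LS.*S Ps) (gs *S ps) (Eval.onePlus~ n ≡.refl)
        (Eval.*S~ Gs gs Ps ps
          (Eval.powS~ {LS.geom oneL n} {g} m (Eval.geom~ n ≡.refl))
          (Eval.powS~ {LS.prodList (map pair (oddsBelow ℓ))} {prodList (map (λ _ → g *S g) (oddsBelow ℓ))} (suc m)
            (Eval.prodList~ {pair} {λ _ → g *S g} (oddsBelow ℓ) λ a →
              Eval.*S~ (LS.geom (zetaL (+ a)) n) g (LS.geom (zetaL (ℤ.- (+ a))) n) g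
                (Eval.geom~ n ≡.refl) (Eval.geom~ n ≡.refl)))))
    where
    f g gs ps : Series
    f  = onePlus (+ 1) n
    g  = geom (+ 1) n
    gs = powS g m
    ps = powS (prodList (map (λ _ → g *S g) (oddsBelow ℓ))) (suc m)

    pair : ℕ → LS.Series
    pair a = LS.geom (zetaL (+ a)) n LS.*S LS.geom (zetaL (ℤ.- (+ a))) n

    F₂ F₋₂ Gs Ps : LS.Series
    F₂  = LS.onePlus (zetaL (+ 2)) n
    F₋₂ = LS.onePlus (zetaL (ℤ.- (+ 2))) n
    Gs  = LS.powS (LS.geom oneL n) m
    Ps  = LS.powS (LS.prodList (map pair (oddsBelow ℓ))) (suc m)

  embed-pFactor : ∀ k j n → pFactor k j n Embed.≈~ (powS (onePlus (+ 1) n) j *S powS (geom (+ 1) n) k)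
  embed-pFactor k j n =
    Embed.*S~ (NS.powS (NS.onePlus 1 n) j) (powS (onePlus (+ 1) n) j)
              (NS.powS (NS.geom 1 n) k) (powS (geom (+ 1) n) k)
      (Embed.powS~ {NS.onePlus 1 n} {onePlus (+ 1) n} j (Embed.onePlus~ n ≡.refl))
      (Embed.powS~ {NS.geom 1 n} {geom (+ 1) n} k (Embed.geom~ n ≡.refl))

  eval-Ccoef : ∀ ℓ m k → m ℕ.+ (length (oddsBelow ℓ) ℕ.+ length (oddsBelow ℓ)) ℕ.* suc m ≡ k →
               ∀ N → eval1 (Ccoef ℓ m N) ≡ + p k 2 N
  eval-Ccoef ℓ m k ≡.refl N = begin
    eval1 (Ccoef ℓ m N)                ≡⟨ Eval.prodTo~ {CFactor ℓ m} {crankFactorℤ ℓ m} N (eval-crankFactor ℓ m) N ⟩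
    prodTo (crankFactorℤ ℓ m) N N      ≡⟨ S.trans (prodTo≈Π {crankFactorℤ ℓ m} {pFactorℤ} N (λ n →
                                            crank-factor-at-one (onePlus (+ 1) n) (geom (+ 1) n) (oddsBelow ℓ) m))
                                            (S.sym (prodTo≈Π N (λ n → S.refl {pFactorℤ n}))) N ⟩
    prodTo pFactorℤ N N                ≡⟨ Embed.prodTo~ {pFactor k 2} {pFactorℤ} N (embed-pFactor k 2) N ⟨
    + p k 2 N                          ∎
    where
    open ≡.≡-Reasoning
    pFactorℤ : ℕ → Series
    pFactorℤ n = powS (onePlus (+ 1) n) 2 *S powS (geom (+ 1) n) k

-- Quadratic residues and triangular numbers

∤2⇒odd : ∀ n → ¬ 2 ∣ n → ∃ λ h → n ≡ suc (h ℕ.+ h)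
∤2⇒odd n 2∤n with n % 2 in n%2≡ | m%n<n n 2 | m≡m%n+[m/n]*n n 2
... | 0 | _ | n≡ = ⊥-elim (2∤n (ℕ∣.m%n≡0⇒n∣m n 2 n%2≡))
... | 1 | _ | n≡ = n / 2 , ≡.trans n≡ (≡.cong suc
  (≡.trans (ℕₚ.*-comm (n / 2) 2) (≡.cong (n / 2 ℕ.+_) (ℕₚ.+-identityʳ (n / 2)))))
... | suc (suc _) | ℕ.s≤s (ℕ.s≤s ()) | _

[2r+1]²≡8tri+1 : ∀ r → suc (r ℕ.+ r) ℕ.* suc (r ℕ.+ r) ≡ 8 ℕ.* tri r ℕ.+ 1
[2r+1]²≡8tri+1 zero    = ≡.refl
[2r+1]²≡8tri+1 (suc r) = begin
  suc (suc r ℕ.+ suc r) ℕ.* suc (suc r ℕ.+ suc r)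
    ≡⟨ solve 1 (λ r → (con 2 :+ r :+ (con 1 :+ r)) :* (con 2 :+ r :+ (con 1 :+ r))
         := (con 1 :+ (r :+ r)) :* (con 1 :+ (r :+ r)) :+ con 8 :* (con 1 :+ r)) ≡.refl r ⟩
  suc (r ℕ.+ r) ℕ.* suc (r ℕ.+ r) ℕ.+ 8 ℕ.* suc r
    ≡⟨ ≡.cong (ℕ._+ 8 ℕ.* suc r) ([2r+1]²≡8tri+1 r) ⟩
  8 ℕ.* tri r ℕ.+ 1 ℕ.+ 8 ℕ.* suc r
    ≡⟨ solve 2 (λ t s → con 8 :* t :+ con 1 :+ con 8 :* s := con 8 :* (s :+ t) :+ con 1) ≡.refl (tri r) (suc r) ⟩
  8 ℕ.* tri (suc r) ℕ.+ 1 ∎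
  where
  open ≡.≡-Reasoning
  open ℕ-Solver

-- If N = ℓ n + δ were tri r + c ℓ, then 8 δ + 1 = (2 r + 1)² + 8 (c - n) ℓ would be a square modulo
-- ℓ.
QNR⇒nonTriangular : ∀ ℓ δ n {N} → QNR (+ 8 ℤ.* δ ℤ.+ + 1) ℓ → + (ℓ ℕ.* n) ℤ.+ δ ≡ + N →
                    ∀ i j → i ℕ.+ j ≡ N → ℓ ∣ j → ¬ Triangular i
QNR⇒nonTriangular ℓ δ n qnr ℓn+δ≡N i j ≡.refl (ℕ∣.divides c ≡.refl) (r , ≡.refl) =
  qnr (x , ∣⇒∣ᵤ {+ ℓ} (divides (+ 8 ℤ.* (+ c ℤ.- + n)) (begin
    (+ 8 ℤ.* δ ℤ.+ + 1) ℤ.- x ℤ.* x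
      ≡⟨ ≡.cong₂ (λ d y → (+ 8 ℤ.* d ℤ.+ + 1) ℤ.- y) δ≡ x²≡ ⟩
    (+ 8 ℤ.* ((+ tri r ℤ.+ + c ℤ.* + ℓ) ℤ.- + ℓ ℤ.* + n) ℤ.+ + 1) ℤ.- (+ 8 ℤ.* + tri r ℤ.+ + 1)
      ≡⟨ solve 4 (λ t c l n → (con (+ 8) :* ((t :+ c :* l) :- l :* n) :+ con (+ 1)) :- (con (+ 8) :* t :+ con (+ 1))
           := (con (+ 8) :* (c :- n)) :* l) ≡.refl (+ tri r) (+ c) (+ ℓ) (+ n) ⟩
    + 8 ℤ.* (+ c ℤ.- + n) ℤ.* + ℓ ∎)))
  where
  open ≡.≡-Reasoning
  open +-*-Solver

  x : ℤ
  x = + suc (r ℕ.+ r)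

  x²≡ : x ℤ.* x ≡ + 8 ℤ.* + tri r ℤ.+ + 1
  x²≡ = begin
    x ℤ.* x                                    ≡⟨ ℤₚ.pos-* (suc (r ℕ.+ r)) (suc (r ℕ.+ r)) ⟨
    + (suc (r ℕ.+ r) ℕ.* suc (r ℕ.+ r))        ≡⟨ ≡.cong +_ ([2r+1]²≡8tri+1 r) ⟩
    + (8 ℕ.* tri r) ℤ.+ + 1                    ≡⟨ ≡.cong (ℤ._+ + 1) (ℤₚ.pos-* 8 (tri r)) ⟩
    + 8 ℤ.* + tri r ℤ.+ + 1                    ∎

  δ≡ : δ ≡ (+ tri r ℤ.+ + c ℤ.* + ℓ) ℤ.- + ℓ ℤ.* + n
  δ≡ = begin
    δ                                                ≡⟨ solve 2 (λ d y → d := (y :+ d) :- y) ≡.refl δ (+ ℓ ℤ.* + n) ⟩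
    (+ ℓ ℤ.* + n ℤ.+ δ) ℤ.- + ℓ ℤ.* + n              ≡⟨ ≡.cong (ℤ._- + ℓ ℤ.* + n) (begin
      + ℓ ℤ.* + n ℤ.+ δ                              ≡⟨ ≡.cong (ℤ._+ δ) (ℤₚ.pos-* ℓ n) ⟨
      + (ℓ ℕ.* n) ℤ.+ δ                              ≡⟨ ℓn+δ≡N ⟩
      + tri r ℤ.+ + (c ℕ.* ℓ)                        ≡⟨ ≡.cong (ℤ._+_ (+ tri r)) (ℤₚ.pos-* c ℓ) ⟩
      + tri r ℤ.+ + c ℤ.* + ℓ                        ∎) ⟩
    (+ tri r ℤ.+ + c ℤ.* + ℓ) ℤ.- + ℓ ℤ.* + n        ∎

-- Divisibility by Φ and the congruence

Φ∣Ccoef : ∀ ℓ h m N → ℓ ≡ suc (h ℕ.+ h) → Prime ℓ →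
          (∀ i j → i ℕ.+ j ≡ N → ℓ ∣ j → ¬ Triangular i) →
          ∃ λ f → LaurentPolynomials._≈L_ (Ccoef ℓ m N) (Φ ℓ *L f)
-- Both gaps close by computation: the crank product over the quotient ring is `Ccoef` itself, and
-- zero plus a multiple of Φ is that multiple.
Φ∣Ccoef ℓ h m N ≡.refl ℓ-prime = C.crank-vanishes m N
  where
  open CyclotomicQuotient ℓ
  module C = Crank quotientRing zetaL (λ i j → Q.refl {zetaL (i ℤ.+ j)}) (Q.refl {oneL}) h ℓ-prime [ℓ]≈0

length-oddsBelow : ∀ ℓ h → ℓ ≡ suc (h ℕ.+ h) → length (oddsBelow ℓ) ≡ h
length-oddsBelow ℓ h ≡.refl = ≡.trans (Listₚ.length-map _ (upTo (ℓ / 2)))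
  (≡.trans (Listₚ.length-upTo (ℓ / 2)) (odd/2 h))

crank-exponent : ∀ ℓ h m → ℓ ≡ suc (h ℕ.+ h) →
                 m ℕ.+ (length (oddsBelow ℓ) ℕ.+ length (oddsBelow ℓ)) ℕ.* suc m ≡ ℓ ℕ.* m ℕ.+ (ℓ ℕ.∸ 1)
crank-exponent ℓ h m ℓ≡ = ≡.trans
  (≡.cong (λ x → m ℕ.+ (x ℕ.+ x) ℕ.* suc m) (length-oddsBelow ℓ h ℓ≡))
  (≡.trans
    (solve 2 (λ h m → m :+ (h :+ h) :* (con 1 :+ m) := (con 1 :+ (h :+ h)) :* m :+ (h :+ h)) ≡.refl h m)
    (≡.cong (λ n → n ℕ.* m ℕ.+ (n ℕ.∸ 1)) (≡.sym ℓ≡)))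
  where open ℕ-Solver

open import Data.Nat using (_*_; _+_; _∸_)

theorem1p1 : (ℓ m : ℕ) → Prime ℓ → ¬ (2 ∣ ℓ) →
    ((N : ℕ) → eval1 (Ccoef ℓ m N) ≡ + p (ℓ * m + (ℓ ∸ 1)) 2 N)
    × ((δ : ℤ) → QNR (+ 8 ℤ.* δ ℤ.+ + 1) ℓ → (n : ℕ) →
    (Φ ℓ ∣L CcoefZ ℓ m (+ (ℓ * n) ℤ.+ δ))
    × (ℓ ∣ pZ (ℓ * m + (ℓ ∸ 1)) 2 (+ (ℓ * n) ℤ.+ δ)))
theorem1p1 ℓ m ℓ-prime 2∤ℓ = at-one , λ δ qnr n →
  congruence (+ (ℓ * n) ℤ.+ δ) (QNR⇒nonTriangular ℓ δ n qnr)
  where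
  open LaurentPolynomials

  k h : ℕ
  k = ℓ * m + (ℓ ∸ 1)
  h = proj₁ (∤2⇒odd ℓ 2∤ℓ)

  ℓ≡ : ℓ ≡ suc (h + h)
  ℓ≡ = proj₂ (∤2⇒odd ℓ 2∤ℓ)

  at-one : ∀ N → eval1 (Ccoef ℓ m N) ≡ + p k 2 N
  at-one = AtOne.eval-Ccoef ℓ m k (crank-exponent ℓ h m ℓ≡)

  -- Setting ζ = 1 in the factorisation gives the numerical congruence, as Φ(1) = ℓ.
  divisible : ∀ N → (∃ λ f → Ccoef ℓ m N ≈L (Φ ℓ *L f)) → (Φ ℓ ∣L Ccoef ℓ m N) × (ℓ ∣ p k 2 N)
  divisible N (f , C≈Φf) = (f , coeffL-cong {Ccoef ℓ m N} {Φ ℓ *L f} C≈Φf) ,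
    ∣⇒∣ᵤ {+ ℓ} {+ p k 2 N} (divides (eval1 f) (begin
      + p k 2 N                 ≡⟨ at-one N ⟨
      eval1 (Ccoef ℓ m N)       ≡⟨ eval1-cong {Ccoef ℓ m N} {Φ ℓ *L f} C≈Φf ⟩
      eval1 (Φ ℓ *L f)          ≡⟨ eval1-* (Φ ℓ) f ⟩
      eval1 (Φ ℓ) ℤ.* eval1 f   ≡⟨ ≡.cong (ℤ._* eval1 f) (eval1-Φ ℓ) ⟩
      + ℓ ℤ.* eval1 f           ≡⟨ ℤₚ.*-comm (+ ℓ) (eval1 f) ⟩
      eval1 f ℤ.* + ℓ           ∎))
    where open ≡.≡-Reasoning

  congruence : ∀ M → (∀ {N} → M ≡ + N → ∀ i j → i + j ≡ N → ℓ ∣ j → ¬ Triangular i) →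
               (Φ ℓ ∣L CcoefZ ℓ m M) × (ℓ ∣ pZ k 2 M)
  congruence (+ N)        nontri = divisible N (Φ∣Ccoef ℓ h m N ℓ≡ ℓ-prime (nontri ≡.refl))
  -- δ may be so negative that the index is too; the coefficients are then 0 by convention, with
  -- cofactor 0.
  congruence (ℤ.-[1+ _ ]) nontri =
    ([] , coeffL-cong {zeroL} {Φ ℓ *L zeroL} (λ w → ≡.sym (*L-comm (Φ ℓ) zeroL w))) , ℓ ℕ∣.∣0
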